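{- Let $p$ be an odd prime, and let $a,b\in\mathbb{Z}$ with $ab\equiv-1\pmod p$. Set $$\{a,b\}_p:=\prod_{\substack{i,j=1\\ i\not\equiv aj,\ i\not\equiv bj\pmod p}}^{(p-1)/2}(i-aj)(i-bj)$$ (which is congruent modulo $p$ to $\prod_{1\le i,j\le (p-1)/2,\ p\nmid i^2-(a+b)ij-j^2}(i^2-(a+b)ij-j^2)$). (i) If $p\equiv1\pmod 4$ and $p\nmid a-b$, then $-\{a,b\}_p\equiv\left(\frac{a-b}{p}\right)\pmod p$. If $p\equiv3\pmod4$, then $-\{a,b\}_p\equiv\left(\frac{a(a-b)}{p}\right)=\left(\frac{a^2+1}{p}\right)\pmod p$. (ii) If $a\equiv b\pmod p$ and $p\equiv1\pmod8$, then $\{a,b\}_p\equiv(-1)^{(p+7)/8}\left(\frac{p-1}{2}\right)!\pmod p$. If $p\equiv5\pmod8$ and $a\equiv b\equiv(-1)^k\left(\frac{p-1}{2}\right)!\pmod p$ with $k\in\{0,1\}$, then $\{a,b\}_p\equiv(-1)^{k+(p-5)/8}\pmod p$.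
   Context: $\left(\frac{\cdot}{p}\right)$ denotes the Legendre symbol. -}

module Defs where

open import Data.Nat as ℕ using (ℕ; zero; suc)
open import Data.Nat.DivMod using (_/_)
open import Data.Integer as ℤ using (ℤ; +_; _-_; _*_; -_)
open import Data.Integer.Divisibility.Signed using (_∣_; _∣?_)
open import Data.List using (List; upTo; map; concatMap; filter; foldr)
open import Data.List.Relation.Unary.Any using (any?)
open import Data.Product using (_×_; _,_)
open import Relation.Nullary using (¬_; yes; no)
open import Relation.Nullary.Decidable using (¬?; _×-dec_)

infix 4 _≡_[mod_]
_≡_[mod_] : ℤ → ℤ → ℕ → Set
x ≡ y [mod p ] = (+ p) ∣ (x - y)

legendre : ℤ → ℕ → ℤ
legendre a p with (+ p) ∣? a
... | yes _ = + 0
... | no _ with any? (λ x → (+ p) ∣? ((+ x) * (+ x) - a)) (upTo p)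
...   | yes _ = + 1
...   | no _  = - (+ 1)

prodℤ : List ℤ → ℤ
prodℤ = foldr _*_ (+ 1)

half : ℕ → List ℕ
half p = map suc (upTo ((p ℕ.∸ 1) / 2))

pairs : ℕ → List (ℕ × ℕ)
pairs p = concatMap (λ i → map (λ j → (i , j)) (half p)) (half p)

lin : ℤ → ℕ × ℕ → ℤ
lin c (i , j) = + i - c * + j

bracket : ℤ → ℤ → ℕ → ℤ
bracket a b p =
  prodℤ (map (λ ij → lin a ij * lin b ij)
    (filter (λ ij → ¬? ((+ p) ∣? lin a ij) ×-dec ¬? ((+ p) ∣? lin b ij)) (pairs p)))

sgn : ℕ → ℤ
sgn n = (- (+ 1)) ℤ.^ n

{-# OPTIONS --safe #-}
module Submission where

-- Let n = (p - 1)/2.  Since ab ≡ -1, the factor i - bj is (j + ai)/a, and after exchanging i and j in these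
-- factors they become the factors i - aj with j replaced by -j.  Hence, up to a power of a, {a,b}_p is
-- ∏_{i=1}^{n} ∏_j (i - aj), where j now runs over all nonzero residues with i ≢ aj and i ≢ bj.  For fixed i,
-- x = i - aj runs over all nonzero residues other than i and i(a² + 1), so by Wilson's theorem the inner
-- product is -1/(i²(a² + 1)), or -1/i when a² ≡ -1.  It remains to multiply over i, with (n!)² ≡ (-1)^(n+1),
-- and to find the power of a: exactly n of the pairs (i, j) satisfy i ≡ aj or i ≡ bj if a ≢ b, and n/2
-- if a ≡ b.  Wilson's theorem and Euler's criterion both come from the involution x ↦ c/x.

open import Defs
open import Algebra.Bundles using (CommutativeMonoid)
import Algebra.Properties.CommutativeMonoid.Sum as Summation
open import Data.Empty using (⊥)
open import Data.Fin as Fin using (Fin; toℕ; fromℕ<; _↑ˡ_; _↑ʳ_; opposite)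
open import Data.Fin.Permutation using (permutation; reverse)
import Data.Fin.Properties as Fin
open import Data.Integer as ℤ using (ℤ; +_; _-_; _*_; -_; _+_; _^_)
open import Data.Integer.DivMod using (_%ℕ_; _/ℕ_; n%ℕd<d; a≡a%ℕn+[a/ℕn]*n)
open import Data.Integer.Divisibility.Signed
open import Data.Integer.Tactic.RingSolver using (solve-∀)
import Data.Integer.Properties as ℤ
open import Data.List using (List; []; _∷_; _++_; upTo; applyUpTo; map; concatMap; filter)
open import Data.List.Properties using (map-∘; map-upTo; map-++)
import Data.List.Membership.Propositional as Membership
import Data.List.Membership.Propositional.Properties as Membership
open import Data.List.Relation.Unary.Any as Any using (any?; satisfied)
open import Data.Nat as ℕ using (ℕ; zero; suc; s≤s; _%_; _/_; _∸_; _!)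
import Data.Nat.Coprimality as Coprimality
import Data.Nat.Divisibility as ℕ
open import Data.Nat.DivMod using (m≡m%n+[m/n]*n; m*n/n≡m)
open import Data.Nat.GCD using (module Bézout)
open import Data.Nat.Primality using (Prime; euclidsLemma; prime⇒nonTrivial)
import Data.Nat.Properties as ℕ
open import Data.Nat.Tactic.RingSolver using () renaming (solve-∀ to ℕ-solve-∀)
open import Data.Product using (_×_; _,_; proj₁; proj₂; ∃-syntax)
open import Data.Sum using (_⊎_; inj₁; inj₂; [_,_]′)
open import Function using (_∘_; id)
open import Level using (Level; 0ℓ)
open import Relation.Binary using (tri<; tri≈; tri>)
open import Relation.Binary.PropositionalEquality
  using (_≡_; refl; sym; trans; cong; cong₂; subst; subst₂; module ≡-Reasoning)
import Relation.Binary.Reasoning.Setoid as SetoidReasoning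
open import Relation.Nullary using (¬_; Dec; yes; no; contradiction)
open import Relation.Nullary.Decidable using (¬?; _×-dec_; _⊎-dec_)
open import Relation.Unary using (Pred; Decidable)

-- On pairs (x, y) modulo p, the congruence ab ≡ -1 says that the quarter turn (x, y) ↦ (y, -x)
-- exchanges the lines x ≡ ay and x ≡ by. This one symmetry lies behind both the exchange of factors
-- and the count: a pair on the second line turns into a point of the first line whose second
-- coordinate lies in -n, ..., -1, and for each x in 1, ..., n the first line has exactly one y,
-- nonzero and hence in one of the two halves. So the two lines together account for n. The gain is
-- that half systems, over which a product is hard to evaluate, become full rows y = 0, ±1, ..., ±n,
-- to which Wilson's theorem applies; completing them by y = 0 costs a factor n!. The leftover power
-- of a is where p mod 4 enters: its exponent is n² - n or n² - n/2, and a^(n²) = (a^n)^n depends on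
-- the parity of n because a^n ≡ ±1.

-- Finite sums in a commutative monoid, used both for products modulo p and for counting.

module FiniteSums {c ℓ} (M : CommutativeMonoid c ℓ) where
  open CommutativeMonoid M
    renaming (refl to ≈-refl; sym to ≈-sym; trans to ≈-trans; reflexive to ≈-reflexive)
  open Summation M public using (sum; sum-cong-≋; sum-cong-≗; ∑-distrib-+; ∑-comm; sum-permute; sum-replicate-zero)
  open SetoidReasoning setoid

  private variable
    p q r : Level
    P : Set p
    Q : Set q
    R : Set r

  when : Dec P → Carrier → Carrier
  when (yes _) x = x
  when (no _)  _ = ε

  when-yes : (d : Dec P) → P → ∀ {x} → when d x ≈ x
  when-yes (yes _) _ = ≈-refl
  when-yes (no ¬h) h = contradiction h ¬h

  when-no : (d : Dec P) → ¬ P → ∀ {x} → when d x ≈ ε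
  when-no (yes h) ¬h = contradiction h ¬h
  when-no (no _)  _  = ≈-refl

  when-cong : (d : Dec P) (e : Dec Q) → (P → Q) → (Q → P) → ∀ {x y} → (P → x ≈ y) →
              when d x ≈ when e y
  when-cong (yes h) e P⇒Q _ x≈y = ≈-trans (x≈y h) (≈-sym (when-yes e (P⇒Q h)))
  when-cong (no ¬h) e _ Q⇒P _   = ≈-sym (when-no e (¬h ∘ Q⇒P))

  when-⊎ : (d : Dec P) (e : Dec Q) (f : Dec R) → (P → Q ⊎ R) → (Q → P) → (R → P) → ¬ (Q × R) →
           ∀ {x} → when d x ≈ when e x ∙ when f x
  when-⊎ d (yes q) (yes r) _ _ _ disjoint = contradiction (q , r) disjoint
  when-⊎ d (yes q) (no _)  _ Q⇒P _ _ = ≈-trans (when-yes d (Q⇒P q)) (≈-sym (identityʳ _))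
  when-⊎ d (no _)  (yes r) _ _ R⇒P _ = ≈-trans (when-yes d (R⇒P r)) (≈-sym (identityˡ _))
  when-⊎ d (no ¬q) (no ¬r) P⇒Q⊎R _ _ _ =
    ≈-trans (when-no d ([ ¬q , ¬r ]′ ∘ P⇒Q⊎R)) (≈-sym (identityˡ _))

  when-complement : (d : Dec P) (e : Dec Q) → (P → ¬ Q) → (¬ P → Q) →
                    ∀ {x} → x ≈ when d x ∙ when e x
  when-complement (yes h) e P⇒¬Q _ = ≈-sym (≈-trans (∙-congˡ (when-no e (P⇒¬Q h))) (identityʳ _))
  when-complement (no ¬h) e _ ¬P⇒Q = ≈-sym (≈-trans (identityˡ _) (when-yes e (¬P⇒Q ¬h)))

  when-∙ : (d : Dec P) → ∀ {x y} → when d (x ∙ y) ≈ when d x ∙ when d y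
  when-∙ (yes _) = ≈-refl
  when-∙ (no _)  = ≈-sym (identityˡ _)

  sum-ε : ∀ {n} (f : Fin n → Carrier) → (∀ i → f i ≈ ε) → sum f ≈ ε
  sum-ε {n} f f≈ε = ≈-trans (sum-cong-≋ f≈ε) (sum-replicate-zero n)

  sum-single : ∀ {n} (f : Fin n → Carrier) i → (∀ j → ¬ j ≡ i → f j ≈ ε) → sum f ≈ f i
  sum-single f Fin.zero f≈ε =
    ≈-trans (∙-congˡ (sum-ε (f ∘ Fin.suc) (λ j → f≈ε (Fin.suc j) λ ()))) (identityʳ _)
  sum-single f (Fin.suc i) f≈ε =
    ≈-trans (∙-cong (f≈ε Fin.zero λ ())
                    (sum-single (f ∘ Fin.suc) i (λ j j≢i → f≈ε (Fin.suc j) (j≢i ∘ Fin.suc-injective))))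
            (identityˡ _)

  sum-↑ : ∀ m {n} (f : Fin (m ℕ.+ n) → Carrier) → sum f ≈ sum (f ∘ (_↑ˡ n)) ∙ sum (f ∘ (m ↑ʳ_))
  sum-↑ zero    f = ≈-sym (identityˡ _)
  sum-↑ (suc m) f = ≈-trans (∙-congˡ (sum-↑ m (f ∘ Fin.suc))) (≈-sym (assoc _ _ _))

  module _ {n} (σ : Fin n → Fin n) (σ-involutive : ∀ i → σ (σ i) ≡ i) where

    private
      trichotomy : (f : Fin n → Carrier) → ∀ i → f i ≈ (when (i Fin.<? σ i) (f i) ∙ when (σ i Fin.<? i) (f i))
                                 ∙ when (σ i Fin.≟ i) (f i)
      trichotomy f i with Fin.<-cmp i (σ i)
      ... | tri< lt ne ngt = ≈-sym (≈-trans
              (∙-cong (∙-cong (when-yes (i Fin.<? σ i) lt) (when-no (σ i Fin.<? i) ngt))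
                      (when-no (σ i Fin.≟ i) (ne ∘ sym)))
              (≈-trans (identityʳ _) (identityʳ _)))
      ... | tri≈ nlt eq ngt = ≈-sym (≈-trans
              (∙-cong (∙-cong (when-no (i Fin.<? σ i) nlt) (when-no (σ i Fin.<? i) ngt))
                      (when-yes (σ i Fin.≟ i) (sym eq)))
              (≈-trans (∙-congʳ (identityˡ _)) (identityˡ _)))
      ... | tri> nlt ne gt = ≈-sym (≈-trans
              (∙-cong (∙-cong (when-no (i Fin.<? σ i) nlt) (when-yes (σ i Fin.<? i) gt))
                      (when-no (σ i Fin.≟ i) (ne ∘ sym)))
              (≈-trans (identityʳ _) (identityˡ _)))

    -- The order on `Fin n` serves only to choose a representative of each 2-cycle: reindexing by
    -- `σ` carries the terms with `σ i` below `i` onto the smaller members.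
    sum-involution : ∀ f → sum f ≈ sum (λ i → when (i Fin.<? σ i) (f i ∙ f (σ i)))
                                   ∙ sum (λ i → when (σ i Fin.≟ i) (f i))
    sum-involution f = begin
      sum f
        ≈⟨ sum-cong-≋ (trichotomy f) ⟩
      sum (λ i → (below i ∙ above i) ∙ fixed i)
        ≈⟨ ∑-distrib-+ _ fixed ⟩
      sum (λ i → below i ∙ above i) ∙ sum fixed
        ≈⟨ ∙-congʳ (∑-distrib-+ below above) ⟩
      (sum below ∙ sum above) ∙ sum fixed
        ≈⟨ ∙-congʳ (∙-congˡ (sum-permute above (permutation σ σ σ-involutive σ-involutive))) ⟩
      (sum below ∙ sum (above ∘ σ)) ∙ sum fixed
        ≈⟨ ∙-congʳ (∑-distrib-+ below (above ∘ σ)) ⟨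
      sum (λ i → below i ∙ above (σ i)) ∙ sum fixed
        ≈⟨ ∙-congʳ (sum-cong-≋ pair) ⟩
      sum (λ i → when (i Fin.<? σ i) (f i ∙ f (σ i))) ∙ sum fixed
        ∎
      where
      below above fixed : Fin n → Carrier
      below i = when (i Fin.<? σ i) (f i)
      above i = when (σ i Fin.<? i) (f i)
      fixed i = when (σ i Fin.≟ i) (f i)
      pair : ∀ i → below i ∙ above (σ i) ≈ when (i Fin.<? σ i) (f i ∙ f (σ i))
      pair i = ≈-sym (≈-trans (when-∙ (i Fin.<? σ i) {f i} {f (σ i)})
        (∙-congˡ (when-cong (i Fin.<? σ i) (σ (σ i) Fin.<? σ i)
          (subst (Fin._< σ i) (sym (σ-involutive i))) (subst (Fin._< σ i) (σ-involutive i))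
          (λ _ → ≈-refl))))

-- Integers modulo p.

module Congruence (p : ℕ) where

  infix 4 _≈_
  -- A record, because `x` and `y` could not be inferred from the bare divisibility of `x - y`.
  record _≈_ (x y : ℤ) : Set where
    constructor congruent
    field divides-difference : x ≡ y [mod p ]
  open _≈_ public

  ≈-by : ∀ {x y z} → + p ∣ z → x - y ≡ z → x ≈ y
  ≈-by p∣z refl = congruent p∣z

  ≈-reflexive : ∀ {x y} → x ≡ y → x ≈ y
  ≈-reflexive {x} refl = ≈-by (divides (+ 0) refl) (ℤ.+-inverseʳ x)

  ≈-refl : ∀ {x} → x ≈ x
  ≈-refl = ≈-reflexive refl

  ≈-sym : ∀ {x y} → x ≈ y → y ≈ x
  ≈-sym {x} {y} (congruent d) = ≈-by (∣m⇒∣-m d) (lemma x y)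
    where
    lemma : ∀ x y → y - x ≡ - (x - y)
    lemma = solve-∀

  ≈-trans : ∀ {x y z} → x ≈ y → y ≈ z → x ≈ z
  ≈-trans {x} {y} {z} (congruent d) (congruent e) = ≈-by (∣m∣n⇒∣m+n d e) (lemma x y z)
    where
    lemma : ∀ x y z → x - z ≡ (x - y) + (y - z)
    lemma = solve-∀

  +-cong : ∀ {x y u v} → x ≈ y → u ≈ v → x + u ≈ y + v
  +-cong {x} {y} {u} {v} (congruent d) (congruent e) = ≈-by (∣m∣n⇒∣m+n d e) (lemma x y u v)
    where
    lemma : ∀ x y u v → (x + u) - (y + v) ≡ (x - y) + (u - v)
    lemma = solve-∀

  neg-cong : ∀ {x y} → x ≈ y → - x ≈ - y
  neg-cong {x} {y} (congruent d) = ≈-by (∣m⇒∣-m d) (lemma x y)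
    where
    lemma : ∀ x y → - x - (- y) ≡ - (x - y)
    lemma = solve-∀

  *-cong : ∀ {x y u v} → x ≈ y → u ≈ v → x * u ≈ y * v
  *-cong {x} {y} {u} {v} (congruent d) (congruent e) =
    ≈-by (∣m∣n⇒∣m+n (∣m⇒∣m*n u d) (∣n⇒∣m*n y e)) (lemma x y u v)
    where
    lemma : ∀ x y u v → (x * u) - (y * v) ≡ (x - y) * u + y * (u - v)
    lemma = solve-∀

  ^-cong : ∀ {x y} n → x ≈ y → x ^ n ≈ y ^ n
  ^-cong zero    x≈y = ≈-refl
  ^-cong (suc n) x≈y = *-cong x≈y (^-cong n x≈y)

  ∣-resp-≈ : ∀ {x y} → x ≈ y → + p ∣ x → + p ∣ y
  ∣-resp-≈ {x} {y} (congruent d) p∣x = subst (+ p ∣_) (lemma x y) (∣m∣n⇒∣m-n p∣x d)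
    where
    lemma : ∀ x y → x - (x - y) ≡ y
    lemma = solve-∀

  ∣-combination : ∀ {u v w} x y → w ≡ x * u + y * v → + p ∣ u → + p ∣ v → + p ∣ w
  ∣-combination x y refl p∣u p∣v = ∣m∣n⇒∣m+n (∣n⇒∣m*n x p∣u) (∣n⇒∣m*n y p∣v)

  product : CommutativeMonoid 0ℓ 0ℓ
  product = record
    { Carrier = ℤ
    ; _≈_ = _≈_
    ; _∙_ = _*_
    ; ε = + 1
    ; isCommutativeMonoid = record
      { isMonoid = record
        { isSemigroup = record
          { isMagma = record
            { isEquivalence = record { refl = ≈-refl ; sym = ≈-sym ; trans = ≈-trans }
            ; ∙-cong = *-cong
            }
          ; assoc = λ x y z → ≈-reflexive (ℤ.*-assoc x y z)
          }
        ; identity = (≈-reflexive ∘ ℤ.*-identityˡ) , (≈-reflexive ∘ ℤ.*-identityʳ)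
        }
      ; comm = λ x y → ≈-reflexive (ℤ.*-comm x y)
      }
    }

-- Complete and half systems of residues modulo p = 2n + 1.

module Residues (n : ℕ) where

  p : ℕ
  p = suc (n ℕ.+ n)

  open Congruence p public

  residue : ℤ → Fin p
  residue x = fromℕ< (n%ℕd<d x p)

  value : Fin p → ℤ
  value i = + toℕ i

  value-residue : ∀ x → value (residue x) ≈ x
  value-residue x = ≈-sym (≈-by (divides (x /ℕ p) refl) (begin
    x - value (residue x)
      ≡⟨ cong₂ _-_ (a≡a%ℕn+[a/ℕn]*n x p) (cong +_ (Fin.toℕ-fromℕ< (n%ℕd<d x p))) ⟩
    (+ (x %ℕ p) + (x /ℕ p) * + p) - + (x %ℕ p)
      ≡⟨ lemma (+ (x %ℕ p)) ((x /ℕ p) * + p) ⟩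
    (x /ℕ p) * + p
      ∎))
    where
    open ≡-Reasoning
    lemma : ∀ r q → (r + q) - r ≡ q
    lemma = solve-∀

  small-multiple : ∀ {m} → m ℕ.< p → + p ∣ + m → m ≡ 0
  small-multiple {zero}  _   _ = refl
  small-multiple {suc m} m<p d = contradiction m<p (ℕ.≤⇒≯ (ℕ.∣⇒≤ (∣⇒∣ᵤ d)))

  value-injective : ∀ {i j} → value i ≈ value j → i ≡ j
  value-injective {i} {j} i≈j = Fin.toℕ-injective
    ([ (λ i≤j → sym (go (Fin.toℕ<n j) i≤j (≈-sym i≈j))) , (λ j≤i → go (Fin.toℕ<n i) j≤i i≈j) ]′
     (ℕ.≤-total (toℕ i) (toℕ j)))
    where
    go : ∀ {k l} → k ℕ.< p → l ℕ.≤ k → + k ≈ + l → k ≡ l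
    go {k} {l} k<p l≤k (congruent d) = ℕ.≤-antisym
      (ℕ.m∸n≡0⇒m≤n (small-multiple (ℕ.≤-<-trans (ℕ.m∸n≤m k l) k<p)
        (subst (+ p ∣_) (trans (ℤ.m-n≡m⊖n k l) (ℤ.⊖-≥ l≤k)) d))) l≤k

  positive : Fin n → ℤ
  positive k = + suc (toℕ k)

  positive-∤ : ∀ k → ¬ (+ p ∣ positive k)
  positive-∤ k d = contradiction (small-multiple (s≤s (ℕ.≤-trans (Fin.toℕ<n k) (ℕ.m≤m+n n n))) d) λ ()

  module Sums {c ℓ} (M : CommutativeMonoid c ℓ) where
    open FiniteSums M public
    open CommutativeMonoid M using (Carrier; _∙_; ε; ∙-cong; ∙-congˡ)
      renaming (_≈_ to _≋_; refl to ≋-refl; sym to ≋-sym; trans to ≋-trans; reflexive to ≋-reflexive)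

    Periodic : (ℤ → Carrier) → Set _
    Periodic h = ∀ {x y} → x ≈ y → h x ≋ h y

    sumAll sumHalf : (ℤ → Carrier) → Carrier
    sumAll h = sum (h ∘ value)
    sumHalf h = sum (h ∘ positive)

    -- The maps `u` and `v` are inverse only modulo p; reducing their values to residues makes them
    -- an honest permutation of `Fin p`, and periodicity of `h` makes the reduction harmless.
    sumAll-reindex : ∀ h → Periodic h → (u v : ℤ → ℤ) →
      (∀ {x y} → x ≈ y → u x ≈ u y) → (∀ {x y} → x ≈ y → v x ≈ v y) →
      (∀ x → u (v x) ≈ x) → (∀ x → v (u x) ≈ x) → sumAll h ≋ sumAll (h ∘ u)
    sumAll-reindex h h-periodic u v u-cong v-cong uv vu =
      ≋-trans (sum-permute (h ∘ value)
                (permutation (lift u) (lift v) (inverse u v u-cong uv) (inverse v u v-cong vu)))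
              (sum-cong-≋ (λ i → h-periodic (value-residue (u (value i)))))
      where
      lift : (ℤ → ℤ) → Fin p → Fin p
      lift w = residue ∘ w ∘ value
      inverse : ∀ w z → (∀ {x y} → x ≈ y → w x ≈ w y) → (∀ x → w (z x) ≈ x) →
                ∀ i → lift w (lift z i) ≡ i
      inverse w z w-cong wz i = value-injective (≈-trans (value-residue _)
        (≈-trans (w-cong (value-residue (z (value i)))) (wz (value i))))

    sumAll-single : ∀ h → Periodic h → ∀ x → (∀ y → ¬ (+ p ∣ y - x) → h y ≋ ε) → sumAll h ≋ h x
    sumAll-single h h-periodic x h≋ε =
      ≋-trans (sum-single (h ∘ value) (residue x)
                (λ j j≢ → h≋ε (value j) (λ d → j≢ (value-injective
                  (≈-trans (congruent d) (≈-sym (value-residue x)))))))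
              (h-periodic (value-residue x))

    -- The residues n + 1, ..., 2n are -n, ..., -1, so the upper block read backwards is the
    -- negative of the lower one.
    sumAll-symmetric : ∀ h → Periodic h → sumAll h ≋ h (+ 0) ∙ (sumHalf h ∙ sumHalf (h ∘ -_))
    sumAll-symmetric h h-periodic = ∙-congˡ (≋-trans (sum-↑ n f) (∙-cong
      (sum-cong-≋ {n} (λ k → ≋-reflexive (cong (h ∘ +_ ∘ suc) (Fin.toℕ-↑ˡ k n))))
      (≋-trans (sum-permute (f ∘ (n ↑ʳ_)) reverse) (sum-cong-≋ {n} (λ k → h-periodic (reflected k))))))
      where
      f : Fin (n ℕ.+ n) → Carrier
      f k = h (+ suc (toℕ k))
      reflected : ∀ k → + suc (toℕ (n ↑ʳ opposite k)) ≈ - positive k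
      reflected k = ≈-by ∣-refl (cong (+_ ∘ suc) (begin
        toℕ (n ↑ʳ opposite k) ℕ.+ suc (toℕ k)
          ≡⟨ cong (ℕ._+ suc (toℕ k)) (trans (Fin.toℕ-↑ʳ n (opposite k)) (cong (n ℕ.+_) (Fin.opposite-prop k))) ⟩
        n ℕ.+ (n ∸ suc (toℕ k)) ℕ.+ suc (toℕ k)
          ≡⟨ ℕ.+-assoc n _ _ ⟩
        n ℕ.+ (n ∸ suc (toℕ k) ℕ.+ suc (toℕ k))
          ≡⟨ cong (n ℕ.+_) (ℕ.m∸n+n≡m (Fin.toℕ<n k)) ⟩
        n ℕ.+ n
          ∎))
        where open ≡-Reasoning

    sumAll-select : ∀ h → Periodic h → ∀ x → sumAll (λ y → when (+ p ∣? y - x) (h y)) ≋ h x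
    sumAll-select h h-periodic x = ≋-trans
      (sumAll-single _ when-periodic x (λ y ∤ → when-no (+ p ∣? y - x) ∤))
      (when-yes (+ p ∣? x - x) (divides-difference (≈-refl {x})))
      where
      when-periodic : Periodic (λ y → when (+ p ∣? y - x) (h y))
      when-periodic {y} {z} y≈z = when-cong (+ p ∣? y - x) (+ p ∣? z - x)
        (∣-resp-≈ (+-cong y≈z ≈-refl)) (∣-resp-≈ (+-cong (≈-sym y≈z) ≈-refl)) (λ _ → h-periodic y≈z)

double-injective : ∀ m n → m ℕ.+ m ≡ n ℕ.+ n → m ≡ n
double-injective m n eq = ℕ.*-cancelˡ-≡ m n 2
  (trans (cong (m ℕ.+_) (ℕ.+-identityʳ m)) (trans eq (cong (n ℕ.+_) (sym (ℕ.+-identityʳ n)))))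

-- Arithmetic modulo an odd prime.

module PrimeResidues (n : ℕ) (p-prime : Prime (suc (n ℕ.+ n))) where
  open Residues n public

  module Π = Sums product
  module Σ = Sums ℕ.+-0-commutativeMonoid
  open SetoidReasoning (CommutativeMonoid.setoid product)

  *-congˡ : ∀ x {y z} → y ≈ z → x * y ≈ x * z
  *-congˡ x = *-cong (≈-refl {x})

  *-congʳ : ∀ {x y} z → x ≈ y → x * z ≈ y * z
  *-congʳ z x≈y = *-cong x≈y (≈-refl {z})

  euclid : ∀ x y → + p ∣ x * y → + p ∣ x ⊎ + p ∣ y
  euclid x y d = [ inj₁ ∘ ∣ᵤ⇒∣ , inj₂ ∘ ∣ᵤ⇒∣ ]′
    (euclidsLemma ℤ.∣ x ∣ ℤ.∣ y ∣ p-prime (subst (p ℕ.∣_) (ℤ.abs-* x y) (∣⇒∣ᵤ d)))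

  ∤-* : ∀ {x y} → ¬ (+ p ∣ x) → ¬ (+ p ∣ y) → ¬ (+ p ∣ x * y)
  ∤-* {x} {y} ¬x ¬y = [ ¬x , ¬y ]′ ∘ euclid x y

  *-cancelˡ : ∀ {x y z} → ¬ (+ p ∣ x) → x * y ≈ x * z → y ≈ z
  *-cancelˡ {x} {y} {z} ¬x (congruent d) =
    [ (λ p∣x → contradiction p∣x ¬x) , congruent ]′
      (euclid x (y - z) (subst (+ p ∣_) (lemma x y z) d))
    where
    lemma : ∀ x y z → x * y - x * z ≡ x * (y - z)
    lemma = solve-∀

  1<p : 1 ℕ.< p
  1<p = ℕ.nonTrivial⇒n>1 p {{prime⇒nonTrivial p-prime}}

  ∤1 : ¬ (+ p ∣ + 1)
  ∤1 d = contradiction (small-multiple 1<p d) λ ()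

  ∤2 : ¬ (+ p ∣ + 2)
  ∤2 d = contradiction (small-multiple (ℕ.≤∧≢⇒< 1<p (2≢p n)) d) λ ()
    where
    2≢p : ∀ m → ¬ 2 ≡ suc (m ℕ.+ m)
    2≢p (suc m) eq with trans (ℕ.suc-injective (ℕ.suc-injective eq)) (ℕ.+-suc m m)
    ... | ()

  ∤-neg : ∀ {x} → ¬ (+ p ∣ x) → ¬ (+ p ∣ - x)
  ∤-neg {x} ¬x d = ¬x (subst (+ p ∣_) (ℤ.neg-involutive x) (∣m⇒∣-m d))

  -- Abstract, since otherwise type checking evaluates the extended Euclidean algorithm.
  abstract
    inverse : ∀ x → ¬ (+ p ∣ x) → ∃[ y ] x * y ≈ + 1
    inverse x ¬x = inv-Bézout (Coprimality.coprime-Bézout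
        (Coprimality.prime⇒coprime p-prime {{ℕ.≢-nonZero m≢0}} (Fin.toℕ<n (residue x))))
      where
      m : ℕ
      m = toℕ (residue x)
      m≢0 : ¬ m ≡ 0
      m≢0 m≡0 = ¬x (∣-resp-≈ (value-residue x) (subst (λ k → + p ∣ + k) (sym m≡0) (divides (+ 0) refl)))
      cast : ∀ k l → + (1 ℕ.+ k ℕ.* l) ≡ + 1 + + k * + l
      cast k l = cong (λ z → + 1 + z) (ℤ.pos-* k l)
      inv-Bézout : Bézout.Identity 1 p m → ∃[ y ] x * y ≈ + 1
      inv-Bézout (Bézout.+- k l eq) = - (+ l) , ≈-trans (*-congʳ (- (+ l)) (≈-sym (value-residue x)))
        (≈-by (divides (- (+ k)) refl) (trans (lemma (+ m) (+ l))
          (trans (cong -_ (trans (sym (cast l m)) (trans (cong +_ eq) (ℤ.pos-* k p)))) (ℤ.neg-distribˡ-* (+ k) (+ p)))))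
        where
        lemma : ∀ m l → m * (- l) - + 1 ≡ - (+ 1 + l * m)
        lemma = solve-∀
      inv-Bézout (Bézout.-+ k l eq) = + l , ≈-trans (*-congʳ (+ l) (≈-sym (value-residue x)))
        (≈-by (divides (+ k) refl) (trans (cong (_- + 1) (trans (ℤ.*-comm (+ m) (+ l))
            (trans (sym (ℤ.pos-* l m)) (trans (cong +_ (sym eq)) (cast k p)))))
          (lemma (+ k * + p))))
        where
        lemma : ∀ m → + 1 + m - + 1 ≡ m
        lemma = solve-∀

  Π-power : ∀ c {m} (f : Fin m → ℕ) → Π.sum (λ i → c ^ f i) ≡ c ^ Σ.sum f
  Π-power c {zero}  f = refl
  Π-power c {suc m} f = trans (cong (c ^ f Fin.zero *_) (Π-power c (f ∘ Fin.suc)))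
                              (sym (ℤ.^-distribˡ-+-* c (f Fin.zero) _))

  Π-const : ∀ c m → Π.sum {m} (λ _ → c) ≡ c ^ m
  Π-const c zero    = refl
  Π-const c (suc m) = cong (c *_) (Π-const c m)

  Σ-const : ∀ c m → Σ.sum {m} (λ _ → c) ≡ m ℕ.* c
  Σ-const c zero    = refl
  Σ-const c (suc m) = cong (c ℕ.+_) (Σ-const c m)

  when-power : ∀ {ℓ} {P : Set ℓ} (d : Dec P) c → Π.when d c ≡ c ^ Σ.when d 1
  when-power (yes _) c = sym (ℤ.*-identityʳ c)
  when-power (no _)  c = refl

  ^-distrib-* : ∀ x y m → (x * y) ^ m ≡ x ^ m * y ^ m
  ^-distrib-* x y zero    = refl
  ^-distrib-* x y (suc m) = trans (cong (x * y *_) (^-distrib-* x y m)) (lemma x y (x ^ m) (y ^ m))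
    where
    lemma : ∀ x y u v → x * y * (u * v) ≡ x * u * (y * v)
    lemma = solve-∀

  factorial : ∀ m → Π.sum {m} (λ k → + suc (toℕ k)) ≈ + (m !)
  factorial zero    = ≈-refl
  factorial (suc m) = begin
    Π.sum {suc m} f                             ≈⟨ Summation.sum-init-last product f ⟩
    Π.sum {m} (f ∘ Fin.inject₁) * f (Fin.fromℕ m)
      ≈⟨ *-cong (Π.sum-cong-≋ {m} (λ k → ≈-reflexive (cong (+_ ∘ suc) (Fin.toℕ-inject₁ k))))
                (≈-reflexive (cong (+_ ∘ suc) (Fin.toℕ-fromℕ m))) ⟩
    Π.sum {m} (λ k → + suc (toℕ k)) * + suc m    ≈⟨ *-congʳ (+ suc m) (factorial m) ⟩
    + (m !) * + suc m                           ≡⟨ ℤ.*-comm (+ (m !)) (+ suc m) ⟩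
    + suc m * + (m !)                           ≡⟨ ℤ.pos-* (suc m) (m !) ⟨
    + (suc m !)                                 ∎
    where
    f : Fin (suc m) → ℤ
    f k = + suc (toℕ k)

  -- The class of 0 contributes 1, so that the product of `nonzero` over all residues is (p - 1)!.
  nonzero : ℤ → ℤ
  nonzero x = Π.when (¬? (+ p ∣? x)) x

  nonzero-∤ : ∀ {x} → ¬ (+ p ∣ x) → nonzero x ≈ x
  nonzero-∤ {x} ¬x = Π.when-yes (¬? (+ p ∣? x)) ¬x

  nonzero-0 : nonzero (+ 0) ≈ + 1
  nonzero-0 = Π.when-no (¬? (+ p ∣? + 0)) (λ ¬0 → ¬0 (divides (+ 0) refl)) {+ 0}

  nonzero-periodic : Π.Periodic nonzero
  nonzero-periodic {x} {y} x≈y = Π.when-cong (¬? (+ p ∣? x)) (¬? (+ p ∣? y))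
    (_∘ ∣-resp-≈ (≈-sym x≈y)) (_∘ ∣-resp-≈ x≈y) (λ _ → x≈y)

  -- The involution x ↦ c/x and the two evaluations of (p - 1)!.

  module Quotients (c : ℤ) (¬c : ¬ (+ p ∣ c)) where

    -- The decision is an explicit argument so that proofs about `σ` can split on it.
    companion : ∀ i → Dec (+ p ∣ value i) → Fin p
    companion i (yes _) = i
    companion i (no ¬i) = residue (c * proj₁ (inverse (value i) ¬i))

    -- x ↦ c/x, fixing 0.
    σ : Fin p → Fin p
    σ i = companion i (+ p ∣? value i)

    σ-zero : ∀ i → + p ∣ value i → σ i ≡ i
    σ-zero i d = by-cases (+ p ∣? value i)
      where
      by-cases : ∀ dec → companion i dec ≡ i
      by-cases (yes _) = refl
      by-cases (no ¬i) = contradiction d ¬i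

    σ-unit : ∀ i → ¬ (+ p ∣ value i) → value i * value (σ i) ≈ c
    σ-unit i ¬i = by-cases (+ p ∣? value i)
      where
      lemma : ∀ x c y → x * (c * y) ≡ c * (x * y)
      lemma = solve-∀
      by-cases : ∀ dec → value i * value (companion i dec) ≈ c
      by-cases (yes d) = contradiction d ¬i
      by-cases (no ¬i) = begin
        value i * value (residue (c * y))  ≈⟨ *-congˡ (value i) (value-residue (c * y)) ⟩
        value i * (c * y)                  ≡⟨ lemma (value i) c y ⟩
        c * (value i * y)                  ≈⟨ *-congˡ c (proj₂ (inverse (value i) ¬i)) ⟩
        c * + 1                            ≡⟨ ℤ.*-identityʳ c ⟩
        c                                  ∎
        where
        y : ℤ
        y = proj₁ (inverse (value i) ¬i)

    σ-unit-∤ : ∀ i → ¬ (+ p ∣ value i) → ¬ (+ p ∣ value (σ i))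
    σ-unit-∤ i ¬i d = ¬c (∣-resp-≈ (σ-unit i ¬i) (∣n⇒∣m*n (value i) d))

    σ-unique : ∀ i x → ¬ (+ p ∣ value i) → value i * x ≈ c → value (σ i) ≈ x
    σ-unique i x ¬i ix≈c = *-cancelˡ ¬i (≈-trans (σ-unit i ¬i) (≈-sym ix≈c))

    σ-involutive : ∀ i → σ (σ i) ≡ i
    σ-involutive i = by-cases (+ p ∣? value i)
      where
      by-cases : Dec (+ p ∣ value i) → σ (σ i) ≡ i
      by-cases (yes d) = trans (cong σ (σ-zero i d)) (σ-zero i d)
      by-cases (no ¬i) = value-injective (σ-unique (σ i) (value i) (σ-unit-∤ i ¬i)
        (≈-trans (≈-reflexive (ℤ.*-comm (value (σ i)) (value i))) (σ-unit i ¬i)))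

    fixed⇒ : ∀ i → σ i ≡ i → + p ∣ value i ⊎ value i * value i ≈ c
    fixed⇒ i σi≡i = by-cases (+ p ∣? value i)
      where
      by-cases : Dec (+ p ∣ value i) → + p ∣ value i ⊎ value i * value i ≈ c
      by-cases (yes d) = inj₁ d
      by-cases (no ¬i) = inj₂ (subst (λ j → value i * value j ≈ c) σi≡i (σ-unit i ¬i))

    square⇒fixed : ∀ i x → x * x ≈ c → value i ≈ x → σ i ≡ i
    square⇒fixed i x x²≈c i≈x = value-injective (σ-unique i (value i)
      (λ d → ¬c (∣-resp-≈ i²≈c (∣n⇒∣m*n (value i) d))) i²≈c)
      where
      i²≈c : value i * value i ≈ c
      i²≈c = ≈-trans (*-cong i≈x i≈x) x²≈c

    ∣⇒∣-0 : ∀ x → + p ∣ x → + p ∣ x - + 0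
    ∣⇒∣-0 x = subst (+ p ∣_) (sym (ℤ.+-identityʳ x))

    ∣-0⇒∣ : ∀ x → + p ∣ x - + 0 → + p ∣ x
    ∣-0⇒∣ x = subst (+ p ∣_) (ℤ.+-identityʳ x)

    module Fixed {a ℓ} (M : CommutativeMonoid a ℓ) where
      open Sums M
      open CommutativeMonoid M using (Carrier; _∙_; ∙-congˡ; ∙-cong)
        renaming (_≈_ to _≋_; refl to ≋-refl; sym to ≋-sym; trans to ≋-trans)

      -- Needed in two monoids: with `nonzero` it is the product of the fixed points, with the
      -- constant 1 it is their number, which in turn fixes the number of pairs.
      fixedSum : (ℤ → Carrier) → Carrier
      fixedSum h = sum (λ i → when (σ i Fin.≟ i) (h (value i)))

      fixedSum-nonsquare : (∀ x → ¬ (x * x ≈ c)) → ∀ h → Periodic h → fixedSum h ≋ h (+ 0)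
      fixedSum-nonsquare nonsquare h h-periodic = ≋-trans
        (sum-cong-≋ {p} (λ i → when-cong (σ i Fin.≟ i) (+ p ∣? value i - + 0)
          (λ eq → [ ∣⇒∣-0 (value i) , (λ sq → contradiction sq (nonsquare (value i))) ]′ (fixed⇒ i eq))
          (σ-zero i ∘ ∣-0⇒∣ (value i)) (λ _ → ≋-refl {h (value i)})))
        (sumAll-select h h-periodic (+ 0))

      fixedSum-square : ∀ s → s * s ≈ c → ∀ h → Periodic h →
                        fixedSum h ≋ h (+ 0) ∙ (h s ∙ h (- s))
      fixedSum-square s s²≈c h h-periodic = ≋-trans (sum-cong-≋ {p} split)
        (≋-trans (∑-distrib-+ (select (+ 0)) (λ i → select s i ∙ select (- s) i))
          (∙-cong (sumAll-select h h-periodic (+ 0))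
          (≋-trans (∑-distrib-+ (select s) (select (- s)))
            (∙-cong (sumAll-select h h-periodic s) (sumAll-select h h-periodic (- s))))))
        where
        at : ∀ i x → Dec (+ p ∣ value i - x)
        at i x = + p ∣? value i - x
        ¬s : ¬ (+ p ∣ s)
        ¬s d = ¬c (∣-resp-≈ s²≈c (∣n⇒∣m*n s d))
        -s²≈c : - s * - s ≈ c
        -s²≈c = ≈-trans (≈-reflexive (lemma s)) s²≈c
          where
          lemma : ∀ s → - s * - s ≡ s * s
          lemma = solve-∀
        square-root : ∀ x → x * x ≈ c → + p ∣ x - s ⊎ + p ∣ x - - s
        square-root x x²≈c = euclid _ _ (subst (+ p ∣_) (lemma x s)
          (divides-difference (≈-trans x²≈c (≈-sym s²≈c))))
          where
          lemma : ∀ x s → x * x - s * s ≡ (x - s) * (x - - s)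
          lemma = solve-∀
        0≉root : ∀ x y → + p ∣ x - + 0 → + p ∣ x - y → + p ∣ y
        0≉root x y = ∣-combination (+ 1) (- (+ 1)) (lemma x y)
          where
          lemma : ∀ x y → y ≡ + 1 * (x - + 0) + - (+ 1) * (x - y)
          lemma = solve-∀
        roots-differ : ∀ x → + p ∣ x - s → + p ∣ x - - s → + p ∣ + 2 * s
        roots-differ x = ∣-combination (- (+ 1)) (+ 1) (lemma x s)
          where
          lemma : ∀ x s → + 2 * s ≡ - (+ 1) * (x - s) + + 1 * (x - - s)
          lemma = solve-∀
        select : ℤ → Fin p → Carrier
        select x i = when (at i x) (h (value i))
        split : ∀ i → when (σ i Fin.≟ i) (h (value i)) ≋ select (+ 0) i ∙ (select s i ∙ select (- s) i)
        split i = ≋-trans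
          (when-⊎ (σ i Fin.≟ i) (at i (+ 0)) (at i s ⊎-dec at i (- s))
            (λ eq → [ inj₁ ∘ ∣⇒∣-0 (value i) , inj₂ ∘ square-root (value i) ]′ (fixed⇒ i eq))
            (σ-zero i ∘ ∣-0⇒∣ (value i))
            [ square⇒fixed i s s²≈c ∘ congruent , square⇒fixed i (- s) -s²≈c ∘ congruent ]′
            (λ (z , r) → [ ¬s ∘ 0≉root (value i) s z , ∤-neg ¬s ∘ 0≉root (value i) (- s) z ]′ r))
          (∙-congˡ (when-⊎ (at i s ⊎-dec at i (- s)) (at i s) (at i (- s)) id inj₁ inj₂
            -- The two roots are distinct because p is odd and s is a unit.
            (λ (d , e) → ∤-* ∤2 ¬s (roots-differ (value i) d e))))

    private
      module FΠ = Fixed product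
      module FΣ = Fixed ℕ.+-0-commutativeMonoid

    pairCount : ℕ
    pairCount = Σ.sum (λ i → Σ.when (i Fin.<? σ i) 1)

    -- Summing the constant 1 along the involution. The fixed points are 0 and the square roots of
    -- c, hence 1 or 3 in number, which gives n or n - 1 pairs.
    residue-count : p ≡ (pairCount ℕ.+ pairCount) ℕ.+ FΣ.fixedSum (λ _ → 1)
    residue-count = trans (sym (trans (Σ-const 1 p) (ℕ.*-identityʳ p)))
      (trans (Σ.sum-involution σ σ-involutive (λ _ → 1))
        (cong (ℕ._+ FΣ.fixedSum (λ _ → 1))
          (trans (Σ.sum-cong-≋ {p} (λ i → Σ.when-∙ (i Fin.<? σ i) {1} {1}))
            (Σ.∑-distrib-+ (λ i → Σ.when (i Fin.<? σ i) 1) (λ i → Σ.when (i Fin.<? σ i) 1)))))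

    product-by-pairs : Π.sumAll nonzero ≈ c ^ pairCount * FΠ.fixedSum nonzero
    product-by-pairs = begin
      Π.sumAll nonzero
        ≈⟨ Π.sum-involution σ σ-involutive (nonzero ∘ value) ⟩
      Π.sum (λ i → Π.when (i Fin.<? σ i) (nonzero (value i) * nonzero (value (σ i)))) * FΠ.fixedSum nonzero
        ≈⟨ *-congʳ (FΠ.fixedSum nonzero) (Π.sum-cong-≋ {p} pair) ⟩
      Π.sum (λ i → c ^ Σ.when (i Fin.<? σ i) 1) * FΠ.fixedSum nonzero
        ≡⟨ cong (_* FΠ.fixedSum nonzero) (Π-power c (λ i → Σ.when (i Fin.<? σ i) 1)) ⟩
      c ^ pairCount * FΠ.fixedSum nonzero
        ∎
      where
      pair : ∀ i → Π.when (i Fin.<? σ i) (nonzero (value i) * nonzero (value (σ i))) ≈ c ^ Σ.when (i Fin.<? σ i) 1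
      pair i = ≈-trans
        (Π.when-cong (i Fin.<? σ i) (i Fin.<? σ i) id id λ lt →
          -- A class strictly below its image cannot be 0, which `σ` fixes; so both members of the
          -- pair are units with product c.
          let ¬i = λ d → Fin.<-irrefl (sym (σ-zero i d)) lt
          in ≈-trans (*-cong (nonzero-∤ ¬i) (nonzero-∤ (σ-unit-∤ i ¬i))) (σ-unit i ¬i))
        (≈-reflexive (when-power (i Fin.<? σ i) c))

    product-nonsquare : (∀ x → ¬ (x * x ≈ c)) → Π.sumAll nonzero ≈ c ^ n
    product-nonsquare nonsquare = begin
      Π.sumAll nonzero                        ≈⟨ product-by-pairs ⟩
      c ^ pairCount * FΠ.fixedSum nonzero
        ≈⟨ *-congˡ (c ^ pairCount) (≈-trans (FΠ.fixedSum-nonsquare nonsquare nonzero nonzero-periodic) nonzero-0) ⟩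
      c ^ pairCount * + 1                     ≡⟨ ℤ.*-identityʳ (c ^ pairCount) ⟩
      c ^ pairCount                           ≡⟨ cong (c ^_) (double-injective n pairCount (ℕ.suc-injective count)) ⟨
      c ^ n                                   ∎
      where
      count : p ≡ suc (pairCount ℕ.+ pairCount)
      count = trans residue-count (trans (cong (pairCount ℕ.+ pairCount ℕ.+_)
        (FΣ.fixedSum-nonsquare nonsquare (λ _ → 1) (λ _ → refl))) (ℕ.+-comm _ 1))

    -- The n - 1 pairs give c^(n - 1) and the roots give s(-s) ≡ -c.
    product-square : ∀ s → s * s ≈ c → Π.sumAll nonzero ≈ - (c ^ n)
    product-square s s²≈c = begin
      Π.sumAll nonzero                         ≈⟨ product-by-pairs ⟩
      c ^ pairCount * FΠ.fixedSum nonzero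
        ≈⟨ *-congˡ (c ^ pairCount) (≈-trans (FΠ.fixedSum-square s s²≈c nonzero nonzero-periodic)
             (*-cong nonzero-0 (*-cong (nonzero-∤ ¬s) (nonzero-∤ (∤-neg ¬s))))) ⟩
      c ^ pairCount * (+ 1 * (s * - s))        ≡⟨ lemma s (c ^ pairCount) ⟩
      - (s * s * c ^ pairCount)                ≈⟨ neg-cong (*-congʳ (c ^ pairCount) s²≈c) ⟩
      - (c ^ suc pairCount)                    ≡⟨ cong (λ k → - (c ^ k)) (double-injective n (suc pairCount) (ℕ.suc-injective count)) ⟨
      - (c ^ n)                                ∎
      where
      ¬s : ¬ (+ p ∣ s)
      ¬s d = ¬c (∣-resp-≈ s²≈c (∣n⇒∣m*n s d))
      lemma : ∀ s u → u * (+ 1 * (s * - s)) ≡ - (s * s * u)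
      lemma = solve-∀
      count : p ≡ suc (suc pairCount ℕ.+ suc pairCount)
      count = trans residue-count (trans (cong (pairCount ℕ.+ pairCount ℕ.+_)
        (FΣ.fixedSum-square s s²≈c (λ _ → 1) (λ _ → refl))) (arith pairCount))
        where
        arith : ∀ k → k ℕ.+ k ℕ.+ 3 ≡ suc (suc k ℕ.+ suc k)
        arith = ℕ-solve-∀

  -- Wilson's theorem, Euler's criterion and their consequences for n!.

  wilson : Π.sumAll nonzero ≈ - (+ 1)
  wilson = ≈-trans (Quotients.product-square (+ 1) ∤1 (+ 1) ≈-refl)
                   (≈-reflexive (cong -_ (ℤ.^-zeroˡ n)))

  -- This and the nonsquare case compare the evaluation of (p - 1)! obtained from c with the one
  -- obtained from 1.
  euler-square : ∀ {c} → ¬ (+ p ∣ c) → ∀ s → s * s ≈ c → c ^ n ≈ + 1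
  euler-square {c} ¬c s s²≈c = ≈-trans (≈-reflexive (sym (ℤ.neg-involutive (c ^ n))))
    (neg-cong (≈-trans (≈-sym (Quotients.product-square c ¬c s s²≈c)) wilson))

  euler-nonsquare : ∀ {c} → ¬ (+ p ∣ c) → (∀ x → ¬ (x * x ≈ c)) → c ^ n ≈ - (+ 1)
  euler-nonsquare {c} ¬c nonsquare = ≈-trans (≈-sym (Quotients.product-nonsquare c ¬c nonsquare)) wilson

  euler : ∀ {c} → ¬ (+ p ∣ c) → legendre c p ≈ c ^ n
  euler {c} ¬c with + p ∣? c
  ... | yes d = contradiction d ¬c
  ... | no _ with any? (λ x → + p ∣? ((+ x) * (+ x) - c)) (upTo p)
  ...   | yes any = ≈-sym (let s , d = satisfied any in euler-square ¬c (+ s) (congruent d))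
  -- The Legendre symbol searches only 0, ..., p - 1, so an arbitrary integer root is first reduced
  -- to its residue.
  ...   | no none = ≈-sym (euler-nonsquare ¬c λ x x²≈c → none
            (Membership.lose (Membership.∈-upTo⁺ (Fin.toℕ<n (residue x)))
              (divides-difference (≈-trans (*-cong (value-residue x) (value-residue x)) x²≈c))))

  -- An n-th power of a unit is thus its own inverse, which later replaces division by `a ^ n` and
  -- `t ^ n`.
  euler-square² : ∀ {c} → ¬ (+ p ∣ c) → c ^ n * c ^ n ≈ + 1
  euler-square² {c} ¬c = ≈-trans (≈-sym (*-cong (euler ¬c) (euler ¬c))) legendre²
    where
    legendre² : legendre c p * legendre c p ≈ + 1
    legendre² with + p ∣? c
    ... | yes d = contradiction d ¬c
    ... | no _ with any? (λ x → + p ∣? ((+ x) * (+ x) - c)) (upTo p)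
    ...   | yes _ = ≈-refl
    ...   | no _  = ≈-refl

  half-factorial : Π.sumHalf id ≈ + (n !)
  half-factorial = factorial n

  -- Wilson's theorem over the residues ±1, ..., ±n: the negative half contributes (-1)^n n!.
  half-wilson : sgn n * (+ (n !) * + (n !)) ≈ - (+ 1)
  half-wilson = begin
    sgn n * (+ (n !) * + (n !))
      ≡⟨ lemma (sgn n) (+ (n !)) ⟩
    + 1 * (+ (n !) * (sgn n * + (n !)))
      ≈⟨ *-cong nonzero-0 (*-cong below above) ⟨
    nonzero (+ 0) * (Π.sumHalf nonzero * Π.sumHalf (nonzero ∘ -_))
      ≈⟨ Π.sumAll-symmetric nonzero nonzero-periodic ⟨
    Π.sumAll nonzero
      ≈⟨ wilson ⟩
    - (+ 1) ∎
    where
    lemma : ∀ s f → s * (f * f) ≡ + 1 * (f * (s * f))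
    lemma = solve-∀
    below : Π.sumHalf nonzero ≈ + (n !)
    below = ≈-trans (Π.sum-cong-≋ {n} (λ k → nonzero-∤ (positive-∤ k))) half-factorial
    above : Π.sumHalf (nonzero ∘ -_) ≈ sgn n * + (n !)
    above = ≈-trans (Π.sum-cong-≋ {n} (λ k → ≈-trans (nonzero-∤ (∤-neg (positive-∤ k)))
                                                   (≈-reflexive (sym (ℤ.-1*i≡-i (positive k))))))
      (≈-trans (Π.∑-distrib-+ {n} _ _) (*-cong (≈-reflexive (Π-const (- (+ 1)) n)) half-factorial))

-- Signs and products over lists.

^-double : ∀ x m → x ^ (m ℕ.+ m) ≡ (x * x) ^ m
^-double x zero    = refl
^-double x (suc m) = trans (cong (λ k → x * x ^ k) (ℕ.+-suc m m))
  (trans (sym (ℤ.*-assoc x x _)) (cong (x * x *_) (^-double x m)))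

sgn-double : ∀ m → sgn (m ℕ.+ m) ≡ + 1
sgn-double m = trans (^-double (- (+ 1)) m) (ℤ.^-zeroˡ m)

sgn² : ∀ m → sgn m * sgn m ≡ + 1
sgn² m = trans (sym (ℤ.^-distribˡ-+-* (- (+ 1)) m m)) (sgn-double m)

prodℤ-++ : ∀ xs ys → prodℤ (xs ++ ys) ≡ prodℤ xs * prodℤ ys
prodℤ-++ []       ys = sym (ℤ.*-identityˡ (prodℤ ys))
prodℤ-++ (x ∷ xs) ys = trans (cong (x *_) (prodℤ-++ xs ys)) (sym (ℤ.*-assoc x (prodℤ xs) (prodℤ ys)))

prodℤ-concatMap : ∀ {A B : Set} (f : B → ℤ) (g : A → List B) xs →
                  prodℤ (map f (concatMap g xs)) ≡ prodℤ (map (λ x → prodℤ (map f (g x))) xs)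
prodℤ-concatMap f g []       = refl
prodℤ-concatMap f g (x ∷ xs) = trans (cong prodℤ (map-++ f (g x) (concatMap g xs)))
  (trans (prodℤ-++ (map f (g x)) _) (cong (prodℤ (map f (g x)) *_) (prodℤ-concatMap f g xs)))

-- The bracket as a double product, and the quarter turn.

module Bracket (n : ℕ) (p-prime : Prime (suc (n ℕ.+ n))) (a b : ℤ)
               (ab≡-1 : a * b ≡ - (+ 1) [mod suc (n ℕ.+ n) ]) where
  open PrimeResidues n p-prime public
  open SetoidReasoning (CommutativeMonoid.setoid product)

  prodℤ-filter : ∀ {A : Set} {P : Pred A 0ℓ} (P? : Decidable P) f xs →
                 prodℤ (map f (filter P? xs)) ≡ prodℤ (map (λ x → Π.when (P? x) (f x)) xs)
  prodℤ-filter P? f []       = refl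
  prodℤ-filter P? f (x ∷ xs) with P? x
  ... | yes _ = cong (f x *_) (prodℤ-filter P? f xs)
  ... | no _  = trans (prodℤ-filter P? f xs) (sym (ℤ.*-identityˡ _))

  prodℤ-applyUpTo : ∀ (f : ℕ → ℤ) m → prodℤ (applyUpTo f m) ≡ Π.sum {m} (f ∘ toℕ)
  prodℤ-applyUpTo f zero    = refl
  prodℤ-applyUpTo f (suc m) = cong (f 0 *_) (prodℤ-applyUpTo (f ∘ suc) m)

  half-p : (p ∸ 1) / 2 ≡ n
  half-p = trans (cong (_/ 2) (trans (cong (n ℕ.+_) (sym (ℕ.+-identityʳ n))) (ℕ.*-comm 2 n))) (m*n/n≡m n 2)

  prodℤ-half : ∀ f → prodℤ (map f (half p)) ≡ Π.sum {n} (f ∘ suc ∘ toℕ)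
  prodℤ-half f = trans (cong (λ k → prodℤ (map f (map suc (upTo k)))) half-p)
    (trans (cong prodℤ (trans (sym (map-∘ (upTo n))) (map-upTo (f ∘ suc) n))) (prodℤ-applyUpTo (f ∘ suc) n))

  admissible : ∀ x y → Dec ((¬ (+ p ∣ x - a * y)) × (¬ (+ p ∣ x - b * y)))
  admissible x y = ¬? (+ p ∣? x - a * y) ×-dec ¬? (+ p ∣? x - b * y)

  Π² : (ℤ → ℤ → ℤ) → ℤ
  Π² h = Π.sumHalf (λ x → Π.sumHalf (h x))

  Σ² : (ℤ → ℤ → ℕ) → ℕ
  Σ² h = Σ.sumHalf (λ x → Σ.sumHalf (h x))

  admissibleTerm : ℤ → ℤ → ℤ
  admissibleTerm x y = Π.when (admissible x y) ((x - a * y) * (x - b * y))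

  -- Pairs removed by the filter become factors 1, so that the index set is the full square and its
  -- two coordinates can be exchanged.
  bracket-Π² : bracket a b p ≈ Π² admissibleTerm
  bracket-Π² = ≈-reflexive (trans
    (prodℤ-filter (λ ij → ¬? (+ p ∣? lin a ij) ×-dec ¬? (+ p ∣? lin b ij)) (λ ij → lin a ij * lin b ij) (pairs p))
    (trans (prodℤ-concatMap term (λ i → map (λ j → (i , j)) (half p)) (half p))
      (trans (prodℤ-half _) (Π.sum-cong-≗ {n} (λ k →
        trans (cong prodℤ (sym (map-∘ (half p)))) (prodℤ-half (λ j → term (suc (toℕ k) , j))))))))
    where
    term : ℕ × ℕ → ℤ
    term ij = Π.when (¬? (+ p ∣? lin a ij) ×-dec ¬? (+ p ∣? lin b ij)) (lin a ij * lin b ij)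

  Π²-cong : ∀ g h → (∀ x y → g x y ≈ h x y) → Π² g ≈ Π² h
  Π²-cong g h g≈h = Π.sum-cong-≋ {n} (λ i → Π.sum-cong-≋ {n} (λ j → g≈h (positive i) (positive j)))

  Π²-distrib-* : ∀ g h → Π² (λ x y → g x y * h x y) ≈ Π² g * Π² h
  Π²-distrib-* g h = ≈-trans
    (Π.sum-cong-≋ {n} (λ i → Π.∑-distrib-+ {n} (g (positive i) ∘ positive) (h (positive i) ∘ positive)))
    (Π.∑-distrib-+ {n} _ _)

  Π²-swap : ∀ h → Π² h ≈ Π² (λ x y → h y x)
  Π²-swap h = Π.∑-comm {n} {n} (λ i j → h (positive i) (positive j))

  p∣ab+1 : + p ∣ a * b - - (+ 1)
  p∣ab+1 = ab≡-1

  ab≈-1 : a * b ≈ - (+ 1)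
  ab≈-1 = congruent ab≡-1

  ∤a : ¬ (+ p ∣ a)
  ∤a d = ∤-neg ∤1 (∣-resp-≈ ab≈-1 (∣m⇒∣m*n b d))

  -- Multiplying x - by by a gives y + ax modulo ab + 1. This and the next three lemmas say that (x,
  -- y) ↦ (y, -x) exchanges the two excluded lines, so it preserves admissibility.
  turn-b⇒a : ∀ x y → + p ∣ x - b * y → + p ∣ y - a * - x
  turn-b⇒a x y d = ∣-combination a y (lemma a b x y) d p∣ab+1
    where
    lemma : ∀ a b x y → y - a * - x ≡ a * (x - b * y) + y * (a * b - - (+ 1))
    lemma = solve-∀

  turn-b⇐a : ∀ x y → + p ∣ y - a * - x → + p ∣ x - b * y
  turn-b⇐a x y d = ∣-combination (- b) x (lemma a b x y) d p∣ab+1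
    where
    lemma : ∀ a b x y → x - b * y ≡ - b * (y - a * - x) + x * (a * b - - (+ 1))
    lemma = solve-∀

  turn-a⇒b : ∀ x y → + p ∣ x - a * y → + p ∣ y - b * - x
  turn-a⇒b x y d = ∣-combination b y (lemma a b x y) d p∣ab+1
    where
    lemma : ∀ a b x y → y - b * - x ≡ b * (x - a * y) + y * (a * b - - (+ 1))
    lemma = solve-∀

  turn-a⇐b : ∀ x y → + p ∣ y - b * - x → + p ∣ x - a * y
  turn-a⇐b x y d = ∣-combination (- a) x (lemma a b x y) d p∣ab+1
    where
    lemma : ∀ a b x y → x - a * y ≡ - a * (y - b * - x) + x * (a * b - - (+ 1))
    lemma = solve-∀

  -- Meant for every integer `y`, including 0 and the negatives, so that a row can be completed to
  -- all residues.
  factor : ℤ → ℤ → ℤ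
  factor x y = Π.when (admissible x y) (x - a * y)

  weight : ℤ → ℤ → ℤ
  weight x y = Π.when (admissible x y) a

  factor-periodic : ∀ x → Π.Periodic (factor x)
  factor-periodic x {y} {z} y≈z = Π.when-cong (admissible x y) (admissible x z)
    (λ (¬a , ¬b) → ¬a ∘ ∣-resp-≈ (lin-cong a (≈-sym y≈z)) , ¬b ∘ ∣-resp-≈ (lin-cong b (≈-sym y≈z)))
    (λ (¬a , ¬b) → ¬a ∘ ∣-resp-≈ (lin-cong a y≈z) , ¬b ∘ ∣-resp-≈ (lin-cong b y≈z))
    (λ _ → lin-cong a y≈z)
    where
    lin-cong : ∀ c {u v} → u ≈ v → x - c * u ≈ x - c * v
    lin-cong c u≈v = +-cong (≈-refl {x}) (neg-cong (*-congˡ c u≈v))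

  factor-0 : ∀ {x} → ¬ (+ p ∣ x) → factor x (+ 0) ≈ x
  factor-0 {x} ¬x = ≈-trans (Π.when-yes (admissible x (+ 0))
      (¬x ∘ subst (+ p ∣_) (lemma a x) , ¬x ∘ subst (+ p ∣_) (lemma b x)))
    (≈-reflexive (lemma a x))
    where
    lemma : ∀ c x → x - c * + 0 ≡ x
    lemma = solve-∀

  -- Since ab ≡ -1, multiplying by a turns x - by into y + ax, the factor of (y, -x).
  weighted-term : ∀ x y → admissibleTerm x y * weight x y
                          ≈ factor x y * factor y (- x)
  weighted-term x y = begin
    Π.when D ((x - a * y) * (x - b * y)) * Π.when D a
      ≈⟨ Π.when-∙ D ⟨
    Π.when D ((x - a * y) * (x - b * y) * a)
      ≈⟨ Π.when-cong D D id id (λ _ → value≈) ⟩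
    Π.when D ((x - a * y) * (y - a * - x))
      ≈⟨ Π.when-∙ D ⟩
    Π.when D (x - a * y) * Π.when D (y - a * - x)
      ≈⟨ *-congˡ (factor x y) (Π.when-cong D (admissible y (- x))
           (λ (¬a , ¬b) → ¬b ∘ turn-b⇐a x y , ¬a ∘ turn-a⇐b x y)
           (λ (¬a , ¬b) → ¬b ∘ turn-a⇒b x y , ¬a ∘ turn-b⇒a x y) (λ _ → ≈-refl)) ⟩
    factor x y * factor y (- x) ∎
    where
    D = admissible x y
    lemma : ∀ a b x y → (x - a * y) * (x - b * y) * a - (x - a * y) * (y - a * - x)
                        ≡ (- ((x - a * y) * y)) * (a * b - - (+ 1))
    lemma = solve-∀
    value≈ : (x - a * y) * (x - b * y) * a ≈ (x - a * y) * (y - a * - x)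
    value≈ = ≈-by (∣n⇒∣m*n (- ((x - a * y) * y)) p∣ab+1) (lemma a b x y)

  -- After the turn and an exchange of coordinates, the second half of each term supplies the
  -- entries `factor x (- y)` of the rows. The entry at y = 0 is x itself, and these entries
  -- together make n!.
  bracket-rows : bracket a b p * Π² weight * + (n !) ≈ Π.sumHalf (λ x → Π.sumAll (factor x))
  bracket-rows = begin
    bracket a b p * Π² weight * + (n !)
      ≈⟨ *-cong (*-congʳ (Π² weight) bracket-Π²) row-0 ⟩
    Π² admissibleTerm * Π² weight * Π.sumHalf (λ x → factor x (+ 0))
      ≈⟨ *-congʳ (Π.sumHalf (λ x → factor x (+ 0))) (≈-sym (Π²-distrib-* admissibleTerm weight)) ⟩
    Π² (λ x y → admissibleTerm x y * weight x y) * Π.sumHalf (λ x → factor x (+ 0))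
      ≈⟨ *-congʳ (Π.sumHalf (λ x → factor x (+ 0))) (Π²-cong (λ x y → admissibleTerm x y * weight x y)
           (λ x y → factor x y * factor y (- x)) weighted-term) ⟩
    Π² (λ x y → factor x y * factor y (- x)) * Π.sumHalf (λ x → factor x (+ 0))
      ≈⟨ *-congʳ (Π.sumHalf (λ x → factor x (+ 0))) (≈-trans (Π²-distrib-* factor (λ x y → factor y (- x)))
           (*-congˡ (Π² factor) (Π²-swap (λ x y → factor y (- x))))) ⟩
    Π² factor * Π² (λ x y → factor x (- y)) * Π.sumHalf (λ x → factor x (+ 0))
      ≡⟨ ℤ.*-comm (Π² factor * Π² (λ x y → factor x (- y))) (Π.sumHalf (λ x → factor x (+ 0))) ⟩
    Π.sumHalf (λ x → factor x (+ 0)) * (Π² factor * Π² (λ x y → factor x (- y)))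
      ≈⟨ *-congˡ (Π.sumHalf (λ x → factor x (+ 0))) (≈-sym (Π.∑-distrib-+ {n} _ _)) ⟩
    Π.sumHalf (λ x → factor x (+ 0)) * Π.sumHalf (λ x → Π.sumHalf (factor x) * Π.sumHalf (factor x ∘ -_))
      ≈⟨ ≈-sym (Π.∑-distrib-+ {n} _ _) ⟩
    Π.sumHalf (λ x → factor x (+ 0) * (Π.sumHalf (factor x) * Π.sumHalf (factor x ∘ -_)))
      ≈⟨ Π.sum-cong-≋ {n} (λ i → ≈-sym (Π.sumAll-symmetric (factor (positive i)) (factor-periodic (positive i)))) ⟩
    Π.sumHalf (λ x → Π.sumAll (factor x)) ∎
    where
    row-0 : + (n !) ≈ Π.sumHalf (λ x → factor x (+ 0))
    row-0 = ≈-trans (≈-sym half-factorial) (Π.sum-cong-≋ {n} (λ i → ≈-sym (factor-0 (positive-∤ i))))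

  -- Evaluation of a row by Wilson's theorem.

  -- The excluded point x ≡ by of row x has y ≡ -ax, where x - ay ≡ x(1 + a²) ≡ xt. So `x * t` is
  -- the value lost there, and t ≡ 0 exactly when a ≡ b.
  t : ℤ
  t = a * (a - b)

  outside : ∀ x z → Dec ((¬ (+ p ∣ z)) × (¬ (+ p ∣ z - x * t)))
  outside x z = ¬? (+ p ∣? z) ×-dec ¬? (+ p ∣? z - x * t)

  -- The substitution z = x - ay has inverse y = b(z - x), as -b is the inverse of a.
  row-reindex : ∀ x → Π.sumAll (factor x) ≈ Π.sumAll (λ z → Π.when (outside x z) z)
  row-reindex x = ≈-sym (≈-trans
    (Π.sumAll-reindex h h-periodic (λ y → x - a * y) (λ z → b * (z - x))
      (λ u≈v → +-cong (≈-refl {x}) (neg-cong (*-congˡ a u≈v)))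
      (λ u≈v → *-congˡ b (+-cong u≈v (≈-refl { - x})))
      (λ z → ≈-by (∣n⇒∣m*n (x - z) p∣ab+1) (uv a b x z))
      (λ y → ≈-by (∣n⇒∣m*n (- y) p∣ab+1) (vu a b x y)))
    (Π.sum-cong-≋ {p} (λ i → Π.when-cong (outside x (x - a * value i)) (admissible x (value i))
      (λ (¬a , ¬b) → ¬a , ¬b ∘ λ d → ∣-combination (- (a * a)) (x - a * value i) (to a b x (value i)) d p∣ab+1)
      (λ (¬a , ¬b) → ¬a , ¬b ∘ λ d → ∣-combination (- (b * b)) (- (b * value i) + x * (+ 1 - a * b) + b * b * x)
        (from a b x (value i)) d p∣ab+1)
      (λ _ → ≈-refl {x - a * value i}))))
    where
    h : ℤ → ℤ
    h z = Π.when (outside x z) z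
    h-periodic : Π.Periodic h
    h-periodic {u} {v} u≈v = Π.when-cong (outside x u) (outside x v)
      (λ (¬0 , ¬t) → ¬0 ∘ ∣-resp-≈ (≈-sym u≈v) , ¬t ∘ ∣-resp-≈ (+-cong (≈-sym u≈v) (≈-refl { - (x * t)})))
      (λ (¬0 , ¬t) → ¬0 ∘ ∣-resp-≈ u≈v , ¬t ∘ ∣-resp-≈ (+-cong u≈v (≈-refl { - (x * t)})))
      (λ _ → u≈v)
    uv : ∀ a b x z → x - a * (b * (z - x)) - z ≡ (x - z) * (a * b - - (+ 1))
    uv = solve-∀
    vu : ∀ a b x y → b * (x - a * y - x) - y ≡ (- y) * (a * b - - (+ 1))
    vu = solve-∀
    to : ∀ a b x y → x - a * y - x * (a * (a - b)) ≡ (- (a * a)) * (x - b * y) + (x - a * y) * (a * b - - (+ 1))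
    to = solve-∀
    from : ∀ a b x y → x - b * y ≡ (- (b * b)) * (x - a * y - x * (a * (a - b)))
                                   + (- (b * y) + x * (+ 1 - a * b) + b * b * x) * (a * b - - (+ 1))
    from = solve-∀

  -- The row runs over all units except xt; restoring that one completes (p - 1)!.
  row-generic : ¬ (+ p ∣ t) → ∀ {x} → ¬ (+ p ∣ x) → Π.sumAll (factor x) * (x * t) ≈ - (+ 1)
  row-generic ¬t {x} ¬x = begin
    Π.sumAll (factor x) * (x * t)
      ≈⟨ *-cong (row-reindex x) (≈-sym (Π.sumAll-select id id (x * t))) ⟩
    Π.sumAll (λ z → Π.when (outside x z) z) * Π.sumAll (λ z → Π.when (+ p ∣? z - x * t) z)
      ≈⟨ ≈-sym (Π.∑-distrib-+ (λ i → Π.when (outside x (value i)) (value i))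
           (λ i → Π.when (+ p ∣? value i - x * t) (value i))) ⟩
    Π.sumAll (λ z → Π.when (outside x z) z * Π.when (+ p ∣? z - x * t) z)
      ≈⟨ Π.sum-cong-≋ {p} (λ i → ≈-sym (split (value i))) ⟩
    Π.sumAll nonzero
      ≈⟨ wilson ⟩
    - (+ 1) ∎
    where
    ∤xt : ∀ {z} → + p ∣ z - x * t → ¬ (+ p ∣ z)
    ∤xt {z} d e = ∤-* ¬x ¬t (∣-resp-≈ (congruent {z} {x * t} d) e)
    split : ∀ z → nonzero z ≈ Π.when (outside x z) z * Π.when (+ p ∣? z - x * t) z
    split z = Π.when-⊎ (¬? (+ p ∣? z)) (outside x z) (+ p ∣? z - x * t)
      (λ ¬z → by-cases ¬z (+ p ∣? z - x * t)) proj₁ ∤xt (λ ((_ , ¬d) , d) → ¬d d)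
      where
      by-cases : ¬ (+ p ∣ z) → Dec (+ p ∣ z - x * t) → ((¬ (+ p ∣ z)) × (¬ (+ p ∣ z - x * t))) ⊎ (+ p ∣ z - x * t)
      by-cases ¬z (yes d) = inj₂ d
      by-cases ¬z (no ¬d) = inj₁ (¬z , ¬d)

  -- Here xt ≡ 0, so the two exclusions coincide and no unit is missing.
  row-degenerate : + p ∣ t → ∀ x → Π.sumAll (factor x) ≈ - (+ 1)
  row-degenerate ∣t x = ≈-trans (row-reindex x) (≈-trans
    (Π.sum-cong-≋ {p} (λ i → Π.when-cong (outside x (value i)) (¬? (+ p ∣? value i)) proj₁
      (λ ¬z → ¬z , ¬z ∘ ∣-resp-≈ (z-xt≈z (value i))) (λ _ → ≈-refl {value i})))
    wilson)
    where
    z-xt≈z : ∀ z → z - x * t ≈ z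
    z-xt≈z z = ≈-by (∣m⇒∣-m (∣n⇒∣m*n x ∣t)) (lemma z (x * t))
      where
      lemma : ∀ z u → z - u - z ≡ - u
      lemma = solve-∀

  -- Counting admissible pairs, to find the power of a.

  weightCount : ℕ
  weightCount = Σ² (λ x y → Σ.when (admissible x y) 1)

  Π²-weight : Π² weight ≈ a ^ weightCount
  Π²-weight = ≈-trans
    (Π²-cong weight (λ x y → a ^ Σ.when (admissible x y) 1) (λ x y → ≈-reflexive (when-power (admissible x y) a)))
    (≈-reflexive (trans (Π.sum-cong-≗ {n} (λ i → Π-power a {n} (λ j → Σ.when (admissible (positive i) (positive j)) 1)))
      (Π-power a {n} _)))

  hit : ℤ → ℤ → ℤ → ℕ
  hit c x y = Σ.when (+ p ∣? x - c * y) 1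

  hits : ℤ → ℕ
  hits c = Σ² (hit c)

  -- The turn makes `hits b` the number of solutions of x ≡ ay with y in the negative half. For each
  -- x the only solution is y ≡ -bx, which is never 0, so each of the n rows counts once.
  hits-total : hits a ℕ.+ hits b ≡ n
  hits-total = trans (cong (hits a ℕ.+_) (trans
      (Σ.sum-cong-≋ {n} (λ i → Σ.sum-cong-≋ {n} (λ j →
        Σ.when-cong (+ p ∣? positive i - b * positive j) (+ p ∣? positive j - a * - positive i)
          (turn-b⇒a (positive i) (positive j)) (turn-b⇐a (positive i) (positive j)) (λ _ → refl))))
      (Σ.∑-comm {n} {n} (λ i j → hit a (positive j) (- positive i)))))
    (trans (sym (Σ.∑-distrib-+ {n} _ _)) (trans (Σ.sum-cong-≋ {n} (λ i → row (positive-∤ i)))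
      (trans (Σ-const 1 n) (ℕ.*-identityʳ n))))
    where
    row : ∀ {x} → ¬ (+ p ∣ x) → Σ.sumHalf (hit a x) ℕ.+ Σ.sumHalf (hit a x ∘ -_) ≡ 1
    row {x} ¬x = trans (cong (ℕ._+ (Σ.sumHalf (hit a x) ℕ.+ Σ.sumHalf (hit a x ∘ -_))) (sym hit-0))
      (trans (sym (Σ.sumAll-symmetric (hit a x) (λ y≈z → trans (hit≡ _) (trans (at-periodic y≈z) (sym (hit≡ _))))))
        (trans (Σ.sum-cong-≋ (λ i → hit≡ (value i))) (Σ.sumAll-select (λ _ → 1) (λ _ → refl) (b * - x))))
      where
      at : ℤ → ℕ
      at y = Σ.when (+ p ∣? y - b * - x) 1
      hit≡ : ∀ y → hit a x y ≡ at y
      hit≡ y = Σ.when-cong (+ p ∣? x - a * y) (+ p ∣? y - b * - x) (turn-a⇒b x y) (turn-a⇐b x y) (λ _ → refl)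
      at-periodic : ∀ {y z} → y ≈ z → at y ≡ at z
      at-periodic {y} {z} y≈z = Σ.when-cong (+ p ∣? y - b * - x) (+ p ∣? z - b * - x)
        (∣-resp-≈ (+-cong y≈z (≈-refl { - (b * - x)}))) (∣-resp-≈ (+-cong (≈-sym y≈z) (≈-refl { - (b * - x)}))) (λ _ → refl)
      hit-0 : hit a x (+ 0) ≡ 0
      hit-0 = Σ.when-no (+ p ∣? x - a * + 0) (¬x ∘ subst (+ p ∣_) (lemma a x))
        where
        lemma : ∀ c x → x - c * + 0 ≡ x
        lemma = solve-∀

  Σ²-cong : ∀ g h → (∀ i j → g (positive i) (positive j) ≡ h (positive i) (positive j)) → Σ² g ≡ Σ² h
  Σ²-cong g h g≡h = Σ.sum-cong-≋ {n} (λ i → Σ.sum-cong-≋ {n} (g≡h i))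

  Σ²-distrib-+ : ∀ g h → Σ² (λ x y → g x y ℕ.+ h x y) ≡ Σ² g ℕ.+ Σ² h
  Σ²-distrib-+ g h = trans
    (Σ.sum-cong-≋ {n} (λ i → Σ.∑-distrib-+ {n} (g (positive i) ∘ positive) (h (positive i) ∘ positive)))
    (Σ.∑-distrib-+ {n} _ _)

  excluded : ∀ x y → Dec ((+ p ∣ x - a * y) ⊎ (+ p ∣ x - b * y))
  excluded x y = (+ p ∣? x - a * y) ⊎-dec (+ p ∣? x - b * y)

  weightCount-complement : Σ² (λ x y → Σ.when (excluded x y) 1) ℕ.+ weightCount ≡ n ℕ.* n
  weightCount-complement = trans (sym (Σ²-distrib-+ (λ x y → Σ.when (excluded x y) 1) (λ x y → Σ.when (admissible x y) 1)))
    (trans (Σ²-cong (λ x y → Σ.when (excluded x y) 1 ℕ.+ Σ.when (admissible x y) 1) (λ _ _ → 1)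
      (λ i j → sym (Σ.when-complement (excluded (positive i) (positive j))
      (admissible (positive i) (positive j))
      (λ d (¬a , ¬b) → [ ¬a , ¬b ]′ d) (λ ¬d → ¬d ∘ inj₁ , ¬d ∘ inj₂))))
    (trans (Σ.sum-cong-≋ {n} (λ i → trans (Σ-const 1 n) (ℕ.*-identityʳ n))) (Σ-const n n)))

  -- Distinct lines meet only at y ≡ 0, outside the square, so no excluded pair is counted twice.
  weightCount-generic : ¬ (a ≈ b) → n ℕ.+ weightCount ≡ n ℕ.* n
  weightCount-generic a≉b = trans (cong (ℕ._+ weightCount) (trans (sym hits-total)
    (trans (sym (Σ²-distrib-+ (hit a) (hit b))) (Σ²-cong (λ x y → hit a x y ℕ.+ hit b x y)
      (λ x y → Σ.when (excluded x y) 1) (λ i j → sym (Σ.when-⊎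
      (excluded (positive i) (positive j))
      (+ p ∣? positive i - a * positive j) (+ p ∣? positive i - b * positive j)
      id inj₁ inj₂ (λ (d , e) → disjoint (positive i) (positive j) (positive-∤ j) d e)))))))
    weightCount-complement
    where
    disjoint : ∀ x y → ¬ (+ p ∣ y) → + p ∣ x - a * y → + p ∣ x - b * y → ⊥
    disjoint x y ¬y d e = ∤-* (a≉b ∘ congruent) ¬y (∣-combination (- (+ 1)) (+ 1) (lemma a b x y) d e)
      where
      lemma : ∀ a b x y → (a - b) * y ≡ - (+ 1) * (x - a * y) + + 1 * (x - b * y)
      lemma = solve-∀

  a⇔b : a ≈ b → ∀ x y → (+ p ∣ x - b * y → + p ∣ x - a * y) × (+ p ∣ x - a * y → + p ∣ x - b * y)
  a⇔b a≈b x y = ∣-resp-≈ (+-cong (≈-refl {x}) (neg-cong (*-congʳ y (≈-sym a≈b))))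
                  , ∣-resp-≈ (+-cong (≈-refl {x}) (neg-cong (*-congʳ y a≈b)))

  hits-degenerate : a ≈ b → hits a ≡ hits b
  hits-degenerate a≈b = Σ²-cong (hit a) (hit b) (λ i j → Σ.when-cong
    (+ p ∣? positive i - a * positive j) (+ p ∣? positive i - b * positive j)
    (proj₂ (a⇔b a≈b (positive i) (positive j))) (proj₁ (a⇔b a≈b (positive i) (positive j))) (λ _ → refl))

  -- The lines coincide, and each takes half of the total n.
  weightCount-degenerate : a ≈ b → ∀ m → n ≡ m ℕ.+ m → m ℕ.+ weightCount ≡ n ℕ.* n
  weightCount-degenerate a≈b m n≡2m = trans (cong (ℕ._+ weightCount) (trans m≡hits
    (Σ²-cong (hit a) (λ x y → Σ.when (excluded x y) 1) (λ i j → Σ.when-cong (+ p ∣? positive i - a * positive j)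
      (excluded (positive i) (positive j))
      inj₁ [ id , proj₁ (a⇔b a≈b (positive i) (positive j)) ]′ (λ _ → refl)))))
    weightCount-complement
    where
    m≡hits : m ≡ hits a
    m≡hits = double-injective _ _ (trans (sym n≡2m) (trans (sym hits-total)
      (cong (hits a ℕ.+_) (sym (hits-degenerate a≈b)))))

  -- Assembling the rows and evaluating the bracket.

  -- The rows give B W n!, and the missing values xt multiply to n! t^n; by `row-generic` the
  -- product of all these is (-1)^n. Since (-1)^n (n!)² ≡ -1, multiplying by it removes both
  -- factorials without a division.
  bracket-generic : ¬ (+ p ∣ t) → bracket a b p * a ^ weightCount * t ^ n ≈ - (+ 1)
  bracket-generic ¬t = begin
    B * W * T
      ≡⟨ lemma₁ (B * W * T) ⟩
    - (- (+ 1) * (B * W * T))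
      ≈⟨ neg-cong (*-congʳ (B * W * T) (≈-sym half-wilson)) ⟩
    - (sgn n * (F * F) * (B * W * T))
      ≡⟨ lemma₂ (sgn n) F B W T ⟩
    - (sgn n * (B * W * F * (F * T)))
      ≈⟨ neg-cong (*-congˡ (sgn n) total) ⟩
    - (sgn n * sgn n)
      ≡⟨ cong -_ (sgn² n) ⟩
    - (+ 1) ∎
    where
    B = bracket a b p
    W = a ^ weightCount
    T = t ^ n
    F = + (n !)
    lemma₁ : ∀ u → u ≡ - (- (+ 1) * u)
    lemma₁ = solve-∀
    lemma₂ : ∀ s F B W T → - (s * (F * F) * (B * W * T)) ≡ - (s * (B * W * F * (F * T)))
    lemma₂ = solve-∀
    columns : F * T ≈ Π.sumHalf (λ x → x * t)
    columns = ≈-trans (*-cong (≈-sym half-factorial) (≈-reflexive (sym (Π-const t n))))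
      (≈-sym (Π.∑-distrib-+ {n} _ _))
    total : B * W * F * (F * T) ≈ sgn n
    total = begin
      B * W * F * (F * T)
        ≈⟨ *-cong (*-congʳ F (*-congˡ B (≈-sym Π²-weight))) columns ⟩
      B * Π² weight * F * Π.sumHalf (λ x → x * t)
        ≈⟨ *-congʳ (Π.sumHalf (λ x → x * t)) bracket-rows ⟩
      Π.sumHalf (λ x → Π.sumAll (factor x)) * Π.sumHalf (λ x → x * t)
        ≈⟨ ≈-sym (Π.∑-distrib-+ {n} _ _) ⟩
      Π.sumHalf (λ x → Π.sumAll (factor x) * (x * t))
        ≈⟨ Π.sum-cong-≋ {n} (λ i → row-generic ¬t (positive-∤ i)) ⟩
      Π.sum {n} (λ _ → - (+ 1))
        ≡⟨ Π-const (- (+ 1)) n ⟩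
      sgn n ∎

  bracket-degenerate : + p ∣ t → bracket a b p * a ^ weightCount * + (n !) ≈ sgn n
  bracket-degenerate ∣t = begin
    bracket a b p * a ^ weightCount * + (n !)
      ≈⟨ *-congʳ (+ (n !)) (*-congˡ (bracket a b p) (≈-sym Π²-weight)) ⟩
    bracket a b p * Π² weight * + (n !)
      ≈⟨ bracket-rows ⟩
    Π.sumHalf (λ x → Π.sumAll (factor x))
      ≈⟨ Π.sum-cong-≋ {n} (λ i → row-degenerate ∣t (positive i)) ⟩
    Π.sum {n} (λ _ → - (+ 1))
      ≡⟨ Π-const (- (+ 1)) n ⟩
    sgn n ∎

  a≈b⇒∣t : a ≈ b → + p ∣ t
  a≈b⇒∣t (congruent d) = ∣n⇒∣m*n a d

  ∤t : ¬ (a ≈ b) → ¬ (+ p ∣ t)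
  ∤t a≉b = [ ∤a , a≉b ∘ congruent ]′ ∘ euclid a (a - b)

  cancel-square : ∀ {x y z} → y * y ≈ + 1 → x * y ≈ z → x ≈ z * y
  cancel-square {x} {y} {z} y²≈1 xy≈z = begin
    x            ≡⟨ ℤ.*-identityʳ x ⟨
    x * + 1      ≈⟨ *-congˡ x (≈-sym y²≈1) ⟩
    x * (y * y)  ≡⟨ ℤ.*-assoc x y y ⟨
    x * y * y    ≈⟨ *-congʳ y xy≈z ⟩
    z * y        ∎

  a^n² : a ^ n * a ^ n ≈ + 1
  a^n² = euler-square² ∤a

  -- Read the exponent n² as (a^n)^n with a^n ≡ ±1: an even n kills the sign, an odd n keeps it.
  a^nn-even : ∀ m → n ≡ m ℕ.+ m → a ^ (n ℕ.* n) ≈ + 1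
  a^nn-even m n≡2m = begin
    a ^ (n ℕ.* n)        ≡⟨ ℤ.^-*-assoc a n n ⟨
    (a ^ n) ^ n          ≡⟨ cong ((a ^ n) ^_) n≡2m ⟩
    (a ^ n) ^ (m ℕ.+ m)  ≡⟨ ^-double (a ^ n) m ⟩
    (a ^ n * a ^ n) ^ m  ≈⟨ ^-cong m a^n² ⟩
    (+ 1) ^ m            ≡⟨ ℤ.^-zeroˡ m ⟩
    + 1                  ∎

  a^nn-odd : ∀ m → n ≡ suc (m ℕ.+ m) → a ^ (n ℕ.* n) ≈ a ^ n
  a^nn-odd m n≡ = begin
    a ^ (n ℕ.* n)                ≡⟨ ℤ.^-*-assoc a n n ⟨
    (a ^ n) ^ n                  ≡⟨ cong ((a ^ n) ^_) n≡ ⟩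
    a ^ n * (a ^ n) ^ (m ℕ.+ m)  ≡⟨ cong (a ^ n *_) (^-double (a ^ n) m) ⟩
    a ^ n * (a ^ n * a ^ n) ^ m  ≈⟨ *-congˡ (a ^ n) (^-cong m a^n²) ⟩
    a ^ n * (+ 1) ^ m            ≡⟨ cong (a ^ n *_) (ℤ.^-zeroˡ m) ⟩
    a ^ n * + 1                  ≡⟨ ℤ.*-identityʳ (a ^ n) ⟩
    a ^ n                        ∎

  weight-times : ∀ k → k ℕ.+ weightCount ≡ n ℕ.* n → a ^ weightCount * a ^ k ≡ a ^ (n ℕ.* n)
  weight-times k eq = trans (ℤ.*-comm (a ^ weightCount) (a ^ k))
    (trans (sym (ℤ.^-distribˡ-+-* a k weightCount)) (cong (a ^_) eq))

  neg-bracket : ∀ {u} → ¬ (a ≈ b) → a ^ weightCount ≈ u → u * u ≈ + 1 → - bracket a b p ≈ t ^ n * u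
  neg-bracket {u} a≉b W≈u u²≈1 = begin
    - B                      ≈⟨ neg-cong (cancel-square u²≈1 (cancel-square (euler-square² (∤t a≉b))
                                  (≈-trans (*-congʳ (t ^ n) (*-congˡ B (≈-sym W≈u))) (bracket-generic (∤t a≉b))))) ⟩
    - (- (+ 1) * t ^ n * u)  ≡⟨ lemma (t ^ n) u ⟩
    t ^ n * u                ∎
    where
    B = bracket a b p
    lemma : ∀ T u → - (- (+ 1) * T * u) ≡ T * u
    lemma = solve-∀

  even-generic : ∀ m → n ≡ m ℕ.+ m → ¬ (a ≈ b) → - bracket a b p ≈ legendre (a - b) p
  even-generic m n≡2m a≉b = begin
    - bracket a b p                  ≈⟨ neg-bracket a≉b W≈ a^n² ⟩
    t ^ n * a ^ n                    ≡⟨ cong (_* a ^ n) (^-distrib-* a (a - b) n) ⟩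
    -- One factor a^n comes from t = a(a - b), the other from the exponent n² - n; they cancel,
    -- leaving the symbol of a - b alone.
    a ^ n * (a - b) ^ n * a ^ n      ≡⟨ lemma (a ^ n) ((a - b) ^ n) ⟩
    a ^ n * a ^ n * (a - b) ^ n      ≈⟨ *-congʳ ((a - b) ^ n) a^n² ⟩
    + 1 * (a - b) ^ n                ≡⟨ ℤ.*-identityˡ ((a - b) ^ n) ⟩
    (a - b) ^ n                      ≈⟨ euler (a≉b ∘ congruent) ⟨
    legendre (a - b) p               ∎
    where
    lemma : ∀ u v → u * v * u ≡ u * u * v
    lemma = solve-∀
    W≈ : a ^ weightCount ≈ a ^ n
    W≈ = ≈-trans (cancel-square a^n² (≈-trans (≈-reflexive (weight-times n (weightCount-generic a≉b))) (a^nn-even m n≡2m)))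
                 (≈-reflexive (ℤ.*-identityˡ (a ^ n)))

  odd⇒a≉b : ∀ m → n ≡ suc (m ℕ.+ m) → ¬ (a ≈ b)
  -- If a ≡ b then a² ≡ -1, and the n-th power of this gives 1 ≡ -1; the difference of the two sides
  -- computes to 2.
  odd⇒a≉b m n≡ a≈b = ∤2 (divides-difference (begin
    + 1                             ≈⟨ a^n² ⟨
    a ^ n * a ^ n                   ≡⟨ ^-distrib-* a a n ⟨
    (a * a) ^ n                     ≈⟨ ^-cong n (≈-trans (*-congˡ a a≈b) ab≈-1) ⟩
    sgn n                           ≡⟨ cong sgn n≡ ⟩
    - (+ 1) * sgn (m ℕ.+ m)         ≡⟨ cong (- (+ 1) *_) (sgn-double m) ⟩
    - (+ 1)                         ∎))

  odd-bracket : ∀ m → n ≡ suc (m ℕ.+ m) → - bracket a b p ≈ legendre t p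
  odd-bracket m n≡ = begin
    - bracket a b p  ≈⟨ neg-bracket a≉b W≈1 ≈-refl ⟩
    t ^ n * + 1      ≡⟨ ℤ.*-identityʳ (t ^ n) ⟩
    t ^ n            ≈⟨ euler (∤t a≉b) ⟨
    legendre t p     ∎
    where
    a≉b : ¬ (a ≈ b)
    a≉b = odd⇒a≉b m n≡
    -- For odd n both a^(n²) and a^n are the same sign, so the exponent n² - n leaves nothing and
    -- the factor a stays inside the symbol.
    W≈1 : a ^ weightCount ≈ + 1
    W≈1 = ≈-trans (cancel-square a^n² (≈-trans (≈-reflexive (weight-times n (weightCount-generic a≉b))) (a^nn-odd m n≡)))
                  a^n²

  t≈a²+1 : t ≈ a * a + + 1
  t≈a²+1 = ≈-by (∣m⇒∣-m p∣ab+1) (lemma a b)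
    where
    lemma : ∀ a b → a * (a - b) - (a * a + + 1) ≡ - (a * b - - (+ 1))
    lemma = solve-∀

  factorial² : ∀ m → n ≡ m ℕ.+ m → + (n !) * + (n !) ≈ - (+ 1)
  factorial² m n≡2m = ≈-trans (≈-reflexive (trans (sym (ℤ.*-identityˡ _))
    (cong (_* (+ (n !) * + (n !))) (sym (trans (cong sgn n≡2m) (sgn-double m)))))) half-wilson

  -- From B W n! ≡ 1: the inverse of W is a^m, as W a^m = a^(n²) ≡ 1, and the inverse of n! is -n!,
  -- as (n!)² ≡ -1.
  even-degenerate : ∀ m → n ≡ m ℕ.+ m → a ≈ b → bracket a b p ≈ - (a ^ m * + (n !))
  even-degenerate m n≡2m a≈b = begin
    B                                 ≡⟨ lemma₁ B ⟩
    - (B * + 1 * - (+ 1))             ≈⟨ neg-cong (*-cong (*-congˡ B (≈-sym Wa^m≈1)) (≈-sym (factorial² m n≡2m))) ⟩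
    - (B * (W * a ^ m) * (F * F))     ≡⟨ lemma₂ B W (a ^ m) F ⟩
    - (B * W * F * (a ^ m * F))       ≈⟨ neg-cong (*-congʳ (a ^ m * F) (≈-trans (bracket-degenerate (a≈b⇒∣t a≈b))
                                           (≈-reflexive (trans (cong sgn n≡2m) (sgn-double m))))) ⟩
    - (+ 1 * (a ^ m * F))             ≡⟨ cong -_ (ℤ.*-identityˡ (a ^ m * F)) ⟩
    - (a ^ m * F)                     ∎
    where
    B = bracket a b p
    W = a ^ weightCount
    F = + (n !)
    lemma₁ : ∀ B → B ≡ - (B * + 1 * - (+ 1))
    lemma₁ = solve-∀
    lemma₂ : ∀ B W u F → - (B * (W * u) * (F * F)) ≡ - (B * W * F * (u * F))
    lemma₂ = solve-∀
    Wa^m≈1 : W * a ^ m ≈ + 1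
    Wa^m≈1 = ≈-trans (≈-reflexive (weight-times m (weightCount-degenerate a≈b m n≡2m))) (a^nn-even m n≡2m)

  a^even-degenerate : a ≈ b → ∀ k → a ^ (k ℕ.+ k) ≈ sgn k
  a^even-degenerate a≈b k = ≈-trans (≈-reflexive (^-double a k)) (^-cong k (≈-trans (*-congˡ a a≈b) ab≈-1))

  -- Here m = n/2 = 2k is even, so a^m is the sign (-1)^k because a² ≡ ab ≡ -1, and n! survives.
  degenerate-1mod8 : ∀ k → n ≡ (k ℕ.+ k) ℕ.+ (k ℕ.+ k) → a ≈ b → bracket a b p ≈ sgn (suc k) * + (n !)
  degenerate-1mod8 k n≡ a≈b = begin
    bracket a b p               ≈⟨ even-degenerate (k ℕ.+ k) n≡ a≈b ⟩
    - (a ^ (k ℕ.+ k) * + (n !)) ≈⟨ neg-cong (*-congʳ (+ (n !)) (a^even-degenerate a≈b k)) ⟩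
    - (sgn k * + (n !))         ≡⟨ lemma (sgn k) (+ (n !)) ⟩
    sgn (suc k) * + (n !)       ∎
    where
    lemma : ∀ u F → - (u * F) ≡ - (+ 1) * u * F
    lemma = solve-∀

  -- Now m = 2j + 1 is odd, so one factor a ≡ ±n! remains; with the other n! it makes (n!)² ≡ -1,
  -- and only a sign is left.
  degenerate-5mod8 : ∀ j k → n ≡ suc (j ℕ.+ j) ℕ.+ suc (j ℕ.+ j) → a ≈ b → a ≈ sgn k * + (n !) →
                     bracket a b p ≈ sgn (k ℕ.+ j)
  degenerate-5mod8 j k n≡ a≈b a≈ = begin
    bracket a b p                            ≈⟨ even-degenerate (suc (j ℕ.+ j)) n≡ a≈b ⟩
    - (a * a ^ (j ℕ.+ j) * F)                ≈⟨ neg-cong (*-congʳ F (*-cong a≈ (a^even-degenerate a≈b j))) ⟩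
    - (sgn k * F * sgn j * F)                ≡⟨ lemma₁ (sgn k) (sgn j) F ⟩
    - (sgn k * sgn j * (F * F))              ≈⟨ neg-cong (*-congˡ (sgn k * sgn j) (factorial² (suc (j ℕ.+ j)) n≡)) ⟩
    - (sgn k * sgn j * - (+ 1))              ≡⟨ lemma₂ (sgn k * sgn j) ⟩
    sgn k * sgn j                            ≡⟨ ℤ.^-distribˡ-+-* (- (+ 1)) k j ⟨
    sgn (k ℕ.+ j)                            ∎
    where
    F = + (n !)
    lemma₁ : ∀ u v F → - (u * F * v * F) ≡ - (u * v * (F * F))
    lemma₁ = solve-∀
    lemma₂ : ∀ u → - (u * - (+ 1)) ≡ u
    lemma₂ = solve-∀

-- Passing from n back to p, and the theorem.

-- The theorem asserts equality of the two symbols as integers, so their congruence through Euler's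
-- criterion would not be enough; the searches themselves are compared.
legendre-cong : ∀ x y p → x ≡ y [mod p ] → legendre x p ≡ legendre y p
legendre-cong x y p x≡y with + p ∣? x | + p ∣? y
... | yes _ | yes _ = refl
... | yes d | no ¬d = contradiction (∣-resp-≈ (congruent x≡y) d) ¬d
  where open Congruence p
... | no ¬d | yes d = contradiction (∣-resp-≈ (≈-sym (congruent x≡y)) d) ¬d
  where open Congruence p
... | no _  | no _
  with any? (λ s → + p ∣? ((+ s) * (+ s) - x)) (upTo p) | any? (λ s → + p ∣? ((+ s) * (+ s) - y)) (upTo p)
... | yes _ | yes _ = refl
... | no _  | no _  = refl
... | yes r | no ¬r = contradiction (Any.map (λ {s} d → divides-difference
        (≈-trans (congruent {+ s * + s} {x} d) (congruent x≡y))) r) ¬r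
  where open Congruence p
... | no ¬r | yes r = contradiction (Any.map (λ {s} d → divides-difference
        (≈-trans (congruent {+ s * + s} {y} d) (≈-sym (congruent x≡y)))) r) ¬r
  where open Congruence p

odd-half : ∀ p → p % 2 ≡ 1 → ∃[ n ] p ≡ suc (n ℕ.+ n)
odd-half p odd = p / 2 , trans (m≡m%n+[m/n]*n p 2) (trans (cong (ℕ._+ p / 2 ℕ.* 2) odd) (cong suc (lemma (p / 2))))
  where
  lemma : ∀ q → q ℕ.* 2 ≡ q ℕ.+ q
  lemma = ℕ-solve-∀

-- Halves the division of p = 2n + 1 by d = 2h with odd remainder 2r + 1.
half-of : ∀ {n d} r h .{{_ : ℕ.NonZero d}} → suc (n ℕ.+ n) % d ≡ suc (r ℕ.+ r) → d ≡ h ℕ.+ h →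
          n ≡ r ℕ.+ suc (n ℕ.+ n) / d ℕ.* h
half-of {n} {d} r h rem d≡2h = double-injective n _ (ℕ.suc-injective (trans (m≡m%n+[m/n]*n (suc (n ℕ.+ n)) d)
  (trans (cong₂ ℕ._+_ rem (cong (suc (n ℕ.+ n) / d ℕ.*_) d≡2h)) (cong suc (lemma r (suc (n ℕ.+ n) / d) h)))))
  where
  lemma : ∀ r q h → r ℕ.+ r ℕ.+ q ℕ.* (h ℕ.+ h) ≡ r ℕ.+ q ℕ.* h ℕ.+ (r ℕ.+ q ℕ.* h)
  lemma = ℕ-solve-∀

ceil-eighth : ∀ m → m % 8 ≡ 1 → (m ℕ.+ 7) / 8 ≡ suc (m / 8)
ceil-eighth m rem = trans (cong (_/ 8) (trans (cong (ℕ._+ 7) (trans (m≡m%n+[m/n]*n m 8) (cong (ℕ._+ m / 8 ℕ.* 8) rem)))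
  (lemma (m / 8)))) (m*n/n≡m (suc (m / 8)) 8)
  where
  lemma : ∀ q → 1 ℕ.+ q ℕ.* 8 ℕ.+ 7 ≡ suc q ℕ.* 8
  lemma = ℕ-solve-∀

floor-eighth : ∀ m → m % 8 ≡ 5 → (m ∸ 5) / 8 ≡ m / 8
floor-eighth m rem = trans
  (cong (λ k → (k ∸ 5) / 8) (trans (m≡m%n+[m/n]*n m 8) (cong (ℕ._+ m / 8 ℕ.* 8) rem)))
  (m*n/n≡m (m / 8) 8)

theorem1p3 : (p : ℕ) → Prime p → p % 2 ≡ 1 → (a b : ℤ) → a * b ≡ - (+ 1) [mod p ] →
    ((p % 4 ≡ 1 → ¬ (a ≡ b [mod p ]) →
    - bracket a b p ≡ legendre (a - b) p [mod p ])
    × (p % 4 ≡ 3 →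
    (- bracket a b p ≡ legendre (a * (a - b)) p [mod p ])
    × (legendre (a * (a - b)) p ≡ legendre (a * a + + 1) p)))
    × ((a ≡ b [mod p ] → p % 8 ≡ 1 →
    bracket a b p ≡ sgn ((p ℕ.+ 7) / 8) * + (((p ∸ 1) / 2) !) [mod p ])
    × ((k : ℕ) → k ≡ 0 ⊎ k ≡ 1 → p % 8 ≡ 5 →
    a ≡ sgn k * + (((p ∸ 1) / 2) !) [mod p ] →
    b ≡ sgn k * + (((p ∸ 1) / 2) !) [mod p ] →
    bracket a b p ≡ sgn (k ℕ.+ (p ∸ 5) / 8) [mod p ]))
theorem1p3 p p-prime odd a b ab≡-1 with odd-half p odd
... | n , refl =
  -- With q the quotient of p by 4 or 8, the four cases have n = 2q, 2q + 1, 4q and 4q + 2.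
  ( (λ p≡1 a≢b → divides-difference
      (even-generic (p / 4) (trans (half-of {n} 0 2 p≡1 refl) (quarter (p / 4))) (a≢b ∘ divides-difference)))
  , (λ p≡3 → divides-difference (odd-bracket (p / 4) (trans (half-of {n} 1 2 p≡3 refl) (cong suc (quarter (p / 4)))))
           , legendre-cong (a * (a - b)) (a * a + + 1) p (divides-difference t≈a²+1)) )
  , ( (λ a≡b p≡1 → divides-difference (subst₂ (λ k m → bracket a b p ≈ sgn k * + (m !))
        (sym (ceil-eighth p p≡1)) (sym half-p)
        (degenerate-1mod8 (p / 8) (trans (half-of {n} 0 4 p≡1 refl) (eighth (p / 8))) (congruent a≡b))))
    , λ k _ p≡5 a≡ b≡ → divides-difference (subst (λ j → bracket a b p ≈ sgn (k ℕ.+ j))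
        (sym (floor-eighth p p≡5))
        (degenerate-5mod8 (p / 8) k (trans (half-of {n} 2 4 p≡5 refl) (eighth′ (p / 8)))
          (≈-trans (congruent a≡) (≈-sym (congruent b≡)))
          (subst (λ m → a ≈ sgn k * + (m !)) half-p (congruent a≡)))) )
  where
  open Bracket n p-prime a b ab≡-1 hiding (p)
  quarter : ∀ q → q ℕ.* 2 ≡ q ℕ.+ q
  quarter = ℕ-solve-∀
  eighth : ∀ q → q ℕ.* 4 ≡ (q ℕ.+ q) ℕ.+ (q ℕ.+ q)
  eighth = ℕ-solve-∀
  eighth′ : ∀ q → 2 ℕ.+ q ℕ.* 4 ≡ suc (q ℕ.+ q) ℕ.+ suc (q ℕ.+ q)
  eighth′ = ℕ-solve-∀
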